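{- For every integer $n\ge 1$ the generating function $$f_{2n}(t)=\sum_{m=0}^\infty Z(P_m\times C_{2n})\,t^m$$ is a rational function such that all zeroes of its denominator are complex roots of unity; that is, there are polynomials $p,q$ with $q\neq 0$ such that $f_{2n}(t)=p(t)/q(t)$ and every complex zero of $q$ is a root of unity.
   Context: $P_m$ is the path with $m$ vertices ($P_0$ is the empty graph), $C_n$ is the cycle with $n$ vertices, with the convention $C_2=P_2$ (a single edge). $G\times H$ denotes the Cartesian (grid) product of graphs: $(u,v)$ and $(u',v')$ are adjacent iff ($u=u'$ and $v,v'$ are adjacent in $H$) or ($v=v'$ and $u,u'$ are adjacent in $G$). For a finite graph $G$, $\mathrm{Ind}(G)$ is the independence complex, the simplicial complex whose simplices are the independent sets of $G$. For a finite simplicial complex $X$ put $Z(X)=1-\chi(X)$, where $\chi$ is the unreduced Euler characteristic, and put $Z(G)=Z(\mathrm{Ind}(G))$; equivalently $Z(G)=\sum_{\sigma}(-1)^{|\sigma|}$ over all independent sets $\sigma$ of $G$, including the empty one. In particular $Z$ of the empty graph is $1$. -}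

module Defs where

open import Level using (0ℓ)
open import Data.Empty using (⊥-elim)
open import Data.Nat as ℕ using (ℕ; zero; suc; _∸_; _⊔_)
import Data.Nat.Properties as ℕ
open import Data.Integer as ℤ using (ℤ; 0ℤ; 1ℤ; -1ℤ)
open import Data.Rational as ℚ using (ℚ; 0ℚ; 1ℚ; ½; ∣_∣; 1/_; positive; nonNegative)
import Data.Rational.Properties as ℚ
open import Data.Fin using (Fin; toℕ; remQuot)
import Data.Fin.Properties as Fin
open import Data.Fin.Subset as Subset using (Subset; inside; outside; _∈_; _⊆_)
open import Data.Fin.Subset.Properties using (∉⊥; _∈?_; nonempty?)
open import Data.Vec as Vec using ([]; _∷_)
open import Data.List as List using (List; []; _∷_; _++_)
open import Data.Product using (_×_; _,_; ∃; map₂)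
open import Data.Sum as Sum using (_⊎_; inj₁; inj₂)
open import Relation.Nullary using (¬_; _×-dec_; _⊎-dec_; _→-dec_; ¬?)
open import Relation.Unary using (Pred; Decidable)
import Relation.Binary as B
open import Relation.Binary.PropositionalEquality
  using (_≡_; refl; sym; trans; cong; subst)
open import Relation.Nullary.Decidable.Core using (dec⇒maybe)
open import Tactic.RingSolver using (solve-∀)
open import Tactic.RingSolver.Core.AlmostCommutativeRing
  using (AlmostCommutativeRing; fromCommutativeRing)

------------------------------------------------------------------------
-- Finite simple graphs

record Graph : Set₁ where
  field
    order  : ℕ
    Adj    : B.Rel (Fin order) 0ℓ
    adj?   : B.Decidable Adj
    symm   : ∀ {u v} → Adj u v → Adj v u
    irrefl : ∀ {v} → ¬ Adj v v

open Graph

path : ℕ → Graph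
path m = record
  { order  = m
  ; Adj    = λ i j → Next i j ⊎ Next j i
  ; adj?   = λ i j → (suc (toℕ i) ℕ.≟ toℕ j) ⊎-dec (suc (toℕ j) ℕ.≟ toℕ i)
  ; symm   = Sum.swap
  ; irrefl = Sum.[ ℕ.1+n≢n , ℕ.1+n≢n ]
  }
  where
  Next : B.Rel (Fin m) 0ℓ
  Next i j = suc (toℕ i) ≡ toℕ j

-- For n ≥ 2 the successor modulo n has no fixed point, so that `i ≢ j` is
-- automatic.  For n = 2 both vertices are successors of each other and the
-- cycle is a single edge.
cycle : ℕ → Graph
cycle n = record
  { order  = n
  ; Adj    = λ i j → (¬ i ≡ j) × (Next i j ⊎ Next j i)
  ; adj?   = λ i j → ¬? (i Fin.≟ j) ×-dec (next? i j ⊎-dec next? j i)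
  ; symm   = λ (i≢j , a) → (λ j≡i → i≢j (sym j≡i)) , Sum.swap a
  ; irrefl = λ (v≢v , _) → v≢v refl
  }
  where
  Next : B.Rel (Fin n) 0ℓ
  Next i j = suc (toℕ i) ≡ toℕ j ⊎ (suc (toℕ i) ≡ n × toℕ j ≡ 0)

  next? : B.Decidable Next
  next? i j = (suc (toℕ i) ℕ.≟ toℕ j) ⊎-dec
              ((suc (toℕ i) ℕ.≟ n) ×-dec (toℕ j ℕ.≟ 0))

-- The vertex (u , v) is represented by `Data.Fin.combine u v`.
infixr 7 _□_
_□_ : Graph → Graph → Graph
G □ H = record
  { order  = order G ℕ.* order H
  ; Adj    = λ x y → PairAdj (pair x) (pair y)
  ; adj?   = λ x y → pairAdj? (pair x) (pair y)
  ; symm   = Sum.map (λ (e , a) → sym e , symm H a) (λ (e , a) → sym e , symm G a)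
  ; irrefl = Sum.[ (λ (_ , a) → irrefl H a) , (λ (_ , a) → irrefl G a) ]
  }
  where
  pair : Fin (order G ℕ.* order H) → Fin (order G) × Fin (order H)
  pair = remQuot {order G} (order H)

  PairAdj : B.Rel (Fin (order G) × Fin (order H)) 0ℓ
  PairAdj (u , v) (u′ , v′) = (u ≡ u′ × Adj H v v′) ⊎ (v ≡ v′ × Adj G u u′)

  pairAdj? : B.Decidable PairAdj
  pairAdj? (u , v) (u′ , v′) =
    ((u Fin.≟ u′) ×-dec adj? H v v′) ⊎-dec ((v Fin.≟ v′) ×-dec adj? G u u′)

------------------------------------------------------------------------
-- Finite simplicial complexes, with the empty simplex included

record SimplicialComplex (n : ℕ) : Set₁ where
  field
    Simplex  : Pred (Subset n) 0ℓ
    simplex? : Decidable Simplex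
    empty    : Simplex Subset.⊥
    down     : ∀ {σ τ} → σ ⊆ τ → Simplex τ → Simplex σ

open SimplicialComplex

Independent : (G : Graph) → Pred (Subset (order G)) 0ℓ
Independent G σ = ∀ u v → u ∈ σ → v ∈ σ → ¬ Adj G u v

Ind : (G : Graph) → SimplicialComplex (order G)
Ind G = record
  { Simplex  = Independent G
  ; simplex? = λ σ → Fin.all? λ u → Fin.all? λ v →
                 (u ∈? σ) →-dec ((v ∈? σ) →-dec ¬? (adj? G u v))
  ; empty    = λ u v u∈⊥ → ⊥-elim (∉⊥ u∈⊥)
  ; down     = λ σ⊆τ ind u v u∈σ v∈σ → ind u v (σ⊆τ u∈σ) (σ⊆τ v∈σ)
  }

subsets : ∀ n → List (Subset n)
subsets zero    = [] ∷ []
subsets (suc n) = List.map (outside ∷_) (subsets n) ++ List.map (inside ∷_) (subsets n)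

sumℤ : List ℤ → ℤ
sumℤ = List.foldr ℤ._+_ 0ℤ

-- Only used for nonempty σ.
dim : ∀ {n} → Subset n → ℕ
dim σ = Subset.∣ σ ∣ ∸ 1

χ : ∀ {n} → SimplicialComplex n → ℤ
χ {n} X = sumℤ (List.map (λ σ → -1ℤ ℤ.^ dim σ)
                  (List.filter (λ σ → nonempty? σ ×-dec simplex? X σ) (subsets n)))

Z : Graph → ℤ
Z G = 1ℤ ℤ.- χ (Ind G)

------------------------------------------------------------------------
-- Formal power series and polynomials over ℤ

PowerSeries : Set
PowerSeries = ℕ → ℤ

-- Coefficients in order of increasing degree; trailing zeros are allowed.
Poly : Set
Poly = List ℤ

coeff : Poly → PowerSeries
coeff []      _       = 0ℤ
coeff (a ∷ p) zero    = a
coeff (a ∷ p) (suc k) = coeff p k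

IsZero : Poly → Set
IsZero p = ∀ k → coeff p k ≡ 0ℤ

infixl 7 _⊛_
_⊛_ : PowerSeries → PowerSeries → PowerSeries
(f ⊛ g) k = sumℤ (List.map (λ i → f i ℤ.* g (k ∸ i)) (List.upTo (suc k)))

-- For q ≠ 0 this says f = p / q, because ℤ[[t]] is an integral domain.
infix 4 _≈_/ₚ_
_≈_/ₚ_ : PowerSeries → Poly → Poly → Set
f ≈ p /ₚ q = ∀ k → (coeff q ⊛ f) k ≡ coeff p k

-- f n is the series f_n(t); the theorem concerns even n.
f : ℕ → PowerSeries
f n m = Z (path m □ cycle n)

------------------------------------------------------------------------
-- Real numbers as Cauchy sequences of rationals

Cauchy : (ℕ → ℚ) → Set
Cauchy x = ∀ ε → 0ℚ ℚ.< ε →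
  ∃ λ N → ∀ m n → N ℕ.≤ m → N ℕ.≤ n → ∣ x m ℚ.- x n ∣ ℚ.< ε

record ℝ : Set where
  constructor mkℝ
  field
    seq    : ℕ → ℚ
    cauchy : Cauchy seq

open ℝ

infix 4 _≈ℝ_
_≈ℝ_ : ℝ → ℝ → Set
x ≈ℝ y = ∀ ε → 0ℚ ℚ.< ε → ∃ λ N → ∀ n → N ℕ.≤ n → ∣ seq x n ℚ.- seq y n ∣ ℚ.< ε

fromℚ : ℚ → ℝ
fromℚ a = mkℝ (λ _ → a) λ ε 0<ε →
  0 , λ _ _ _ _ → subst (λ z → ∣ z ∣ ℚ.< ε) (sym (ℚ.+-inverseʳ a)) 0<ε

private
  ring : AlmostCommutativeRing 0ℓ 0ℓ
  ring = fromCommutativeRing ℚ.+-*-commutativeRing (λ a → dec⇒maybe (0ℚ ℚ.≟ a))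

  +-regroup : ∀ a b c d → (a ℚ.+ b) ℚ.- (c ℚ.+ d) ≡ (a ℚ.- c) ℚ.+ (b ℚ.- d)
  +-regroup = solve-∀ ring

  neg-regroup : ∀ a b → ℚ.- (a ℚ.- b) ≡ (ℚ.- a) ℚ.- (ℚ.- b)
  neg-regroup = solve-∀ ring

  *-regroup : ∀ a b c d → a ℚ.* b ℚ.- c ℚ.* d ≡ a ℚ.* (b ℚ.- d) ℚ.+ d ℚ.* (a ℚ.- c)
  *-regroup = solve-∀ ring

  split-at : ∀ a b → a ≡ b ℚ.+ (a ℚ.- b)
  split-at = solve-∀ ring

  factor-out : ∀ b c e i → b ℚ.* (e ℚ.* i) ℚ.+ c ℚ.* (e ℚ.* i) ≡ e ℚ.* ((b ℚ.+ c) ℚ.* i)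
  factor-out = solve-∀ ring

  half-pos : ∀ {ε} → 0ℚ ℚ.< ε → 0ℚ ℚ.< ½ ℚ.* ε
  half-pos {ε} 0<ε = ℚ.positive⁻¹ _ {{ℚ.pos*pos⇒pos ½ ε {{positive 0<ε}}}}

  halves : ∀ ε → ½ ℚ.* ε ℚ.+ ½ ℚ.* ε ≡ ε
  halves ε = trans (sym (ℚ.*-distribʳ-+ ε ½ ½)) (ℚ.*-identityˡ ε)

  +-cauchy : ∀ {x y} → Cauchy x → Cauchy y → Cauchy (λ n → x n ℚ.+ y n)
  +-cauchy {x} {y} cx cy ε 0<ε
    with cx (½ ℚ.* ε) (half-pos 0<ε) | cy (½ ℚ.* ε) (half-pos 0<ε)
  ... | M , hx | N , hy = M ⊔ N , λ m n m≥ n≥ → begin-strict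
      ∣ (x m ℚ.+ y m) ℚ.- (x n ℚ.+ y n) ∣
        ≡⟨ cong ∣_∣ (+-regroup (x m) (y m) (x n) (y n)) ⟩
      ∣ (x m ℚ.- x n) ℚ.+ (y m ℚ.- y n) ∣
        ≤⟨ ℚ.∣p+q∣≤∣p∣+∣q∣ (x m ℚ.- x n) (y m ℚ.- y n) ⟩
      ∣ x m ℚ.- x n ∣ ℚ.+ ∣ y m ℚ.- y n ∣
        <⟨ ℚ.+-mono-< (hx m n (ℕ.m⊔n≤o⇒m≤o M N m≥) (ℕ.m⊔n≤o⇒m≤o M N n≥))
                      (hy m n (ℕ.m⊔n≤o⇒n≤o M N m≥) (ℕ.m⊔n≤o⇒n≤o M N n≥)) ⟩
      ½ ℚ.* ε ℚ.+ ½ ℚ.* ε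
        ≡⟨ halves ε ⟩
      ε ∎
    where open ℚ.≤-Reasoning

  neg-cauchy : ∀ {x} → Cauchy x → Cauchy (λ n → ℚ.- x n)
  neg-cauchy {x} cx ε 0<ε = map₂ (λ h m n m≥ n≥ → subst (ℚ._< ε) (eq m n) (h m n m≥ n≥)) (cx ε 0<ε)
    where
    eq : ∀ m n → ∣ x m ℚ.- x n ∣ ≡ ∣ (ℚ.- x m) ℚ.- (ℚ.- x n) ∣
    eq m n = trans (sym (ℚ.∣-p∣≡∣p∣ (x m ℚ.- x n)))
      (cong ∣_∣ (neg-regroup (x m) (x n)))

  eventually-bounded : ∀ {x} → Cauchy x →
    ∃ λ N → ∃ λ b → 0ℚ ℚ.< b × (∀ n → N ℕ.≤ n → ∣ x n ∣ ℚ.≤ b)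
  eventually-bounded {x} cx with cx 1ℚ (ℚ.positive⁻¹ 1ℚ)
  ... | N , h = N , ∣ x N ∣ ℚ.+ 1ℚ , ℚ.+-mono-≤-< (ℚ.0≤∣p∣ (x N)) (ℚ.positive⁻¹ 1ℚ)
              , λ n n≥ → begin
      ∣ x n ∣                           ≡⟨ cong ∣_∣ (split-at (x n) (x N)) ⟩
      ∣ x N ℚ.+ (x n ℚ.- x N) ∣         ≤⟨ ℚ.∣p+q∣≤∣p∣+∣q∣ (x N) (x n ℚ.- x N) ⟩
      ∣ x N ∣ ℚ.+ ∣ x n ℚ.- x N ∣       ≤⟨ ℚ.+-monoʳ-≤ ∣ x N ∣ (ℚ.<⇒≤ (h n N n≥ ℕ.≤-refl)) ⟩
      ∣ x N ∣ ℚ.+ 1ℚ                    ∎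
    where open ℚ.≤-Reasoning

  bounded : ∀ u v {a d} → 0ℚ ℚ.< a → ∣ u ∣ ℚ.≤ a → ∣ v ∣ ℚ.< d →
            ∣ u ℚ.* v ∣ ℚ.< a ℚ.* d
  bounded u v {a} {d} 0<a u≤a v<d = begin-strict
    ∣ u ℚ.* v ∣        ≡⟨ ℚ.∣p*q∣≡∣p∣*∣q∣ u v ⟩
    ∣ u ∣ ℚ.* ∣ v ∣    ≤⟨ ℚ.*-monoʳ-≤-nonNeg ∣ v ∣ {{nonNegative (ℚ.0≤∣p∣ v)}} {∣ u ∣} {a} u≤a ⟩
    a ℚ.* ∣ v ∣        <⟨ ℚ.*-monoʳ-<-pos a {{positive 0<a}} {∣ v ∣} {d} v<d ⟩
    a ℚ.* d            ∎
    where open ℚ.≤-Reasoning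

  *-pos : ∀ p q → 0ℚ ℚ.< p → 0ℚ ℚ.< q → 0ℚ ℚ.< p ℚ.* q
  *-pos p q 0<p 0<q =
    ℚ.positive⁻¹ (p ℚ.* q) {{ℚ.pos*pos⇒pos p {{positive 0<p}} q {{positive 0<q}}}}

  inverse : ∀ p → 0ℚ ℚ.< p → ∃ λ i → 0ℚ ℚ.< i × p ℚ.* i ≡ 1ℚ
  inverse p 0<p = 1/ p , ℚ.positive⁻¹ (1/ p) {{ℚ.1/pos⇒pos p}} , ℚ.*-inverseʳ p
    where instance
    p-pos : ℚ.Positive p
    p-pos = positive 0<p
    p≢0 : ℚ.NonZero p
    p≢0 = ℚ.pos⇒nonZero p

  share : ∀ b c ε → 0ℚ ℚ.< b → 0ℚ ℚ.< c → 0ℚ ℚ.< ε →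
          ∃ λ δ → 0ℚ ℚ.< δ × b ℚ.* δ ℚ.+ c ℚ.* δ ≡ ε
  share b c ε 0<b 0<c 0<ε with inverse (b ℚ.+ c) (ℚ.+-mono-< {0ℚ} {b} {0ℚ} {c} 0<b 0<c)
  ... | i , 0<i , inv = ε ℚ.* i , *-pos ε i 0<ε 0<i ,
    trans (factor-out b c ε i) (trans (cong (ε ℚ.*_) inv) (ℚ.*-identityʳ ε))

  -- Helper functions instead of `with`, which would normalise a goal
  -- containing products of rationals.
  *-cauchy : ∀ {x y} → Cauchy x → Cauchy y → Cauchy (λ n → x n ℚ.* y n)
  *-cauchy {x} {y} cx cy ε 0<ε = with-bounds (eventually-bounded {x} cx) (eventually-bounded {y} cy)
    where
    Bound : (ℕ → ℚ) → ℕ → ℚ → Set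
    Bound z N b = ∀ n → N ℕ.≤ n → ∣ z n ∣ ℚ.≤ b

    Close : (ℕ → ℚ) → ℚ → Set
    Close z δ = ∃ λ N → ∀ m n → N ℕ.≤ m → N ℕ.≤ n → ∣ z m ℚ.- z n ∣ ℚ.< δ

    combine : ∀ K L b c δ → 0ℚ ℚ.< b → 0ℚ ℚ.< c → Bound x K b → Bound y L c →
              b ℚ.* δ ℚ.+ c ℚ.* δ ≡ ε → Close x δ → Close y δ → Close (λ n → x n ℚ.* y n) ε
    combine K L b c δ 0<b 0<c bx by [b+c]δ≡ε (M , hx) (N , hy) = (K ⊔ L) ⊔ (M ⊔ N) , λ m n m≥ n≥ →
      let KL≤m = ℕ.m⊔n≤o⇒m≤o (K ⊔ L) (M ⊔ N) m≥
          KL≤n = ℕ.m⊔n≤o⇒m≤o (K ⊔ L) (M ⊔ N) n≥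
          MN≤m = ℕ.m⊔n≤o⇒n≤o (K ⊔ L) (M ⊔ N) m≥
          MN≤n = ℕ.m⊔n≤o⇒n≤o (K ⊔ L) (M ⊔ N) n≥
      in begin-strict
      ∣ x m ℚ.* y m ℚ.- x n ℚ.* y n ∣
        ≡⟨ cong ∣_∣ (*-regroup (x m) (y m) (x n) (y n)) ⟩
      ∣ x m ℚ.* (y m ℚ.- y n) ℚ.+ y n ℚ.* (x m ℚ.- x n) ∣
        ≤⟨ ℚ.∣p+q∣≤∣p∣+∣q∣ (x m ℚ.* (y m ℚ.- y n)) (y n ℚ.* (x m ℚ.- x n)) ⟩
      ∣ x m ℚ.* (y m ℚ.- y n) ∣ ℚ.+ ∣ y n ℚ.* (x m ℚ.- x n) ∣
        <⟨ ℚ.+-mono-<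
             (bounded (x m) (y m ℚ.- y n) 0<b (bx m (ℕ.m⊔n≤o⇒m≤o K L KL≤m))
               (hy m n (ℕ.m⊔n≤o⇒n≤o M N MN≤m) (ℕ.m⊔n≤o⇒n≤o M N MN≤n)))
             (bounded (y n) (x m ℚ.- x n) 0<c (by n (ℕ.m⊔n≤o⇒n≤o K L KL≤n))
               (hx m n (ℕ.m⊔n≤o⇒m≤o M N MN≤m) (ℕ.m⊔n≤o⇒m≤o M N MN≤n))) ⟩
      b ℚ.* δ ℚ.+ c ℚ.* δ
        ≡⟨ [b+c]δ≡ε ⟩
      ε ∎
      where open ℚ.≤-Reasoning

    with-bounds : (∃ λ K → ∃ λ b → 0ℚ ℚ.< b × Bound x K b) →
                  (∃ λ L → ∃ λ c → 0ℚ ℚ.< c × Bound y L c) → Close (λ n → x n ℚ.* y n) ε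
    with-bounds (K , b , 0<b , bx) (L , c , 0<c , by) =
      let δ , 0<δ , [b+c]δ≡ε = share b c ε 0<b 0<c 0<ε
      in combine K L b c δ 0<b 0<c bx by [b+c]δ≡ε (cx δ 0<δ) (cy δ 0<δ)

infixl 6 _+ℝ_ _-ℝ_
infixl 7 _*ℝ_

_+ℝ_ : ℝ → ℝ → ℝ
x +ℝ y = mkℝ (λ n → seq x n ℚ.+ seq y n) (+-cauchy {seq x} {seq y} (cauchy x) (cauchy y))

-ℝ_ : ℝ → ℝ
-ℝ x = mkℝ (λ n → ℚ.- seq x n) (neg-cauchy {seq x} (cauchy x))

_-ℝ_ : ℝ → ℝ → ℝ
x -ℝ y = x +ℝ (-ℝ y)

_*ℝ_ : ℝ → ℝ → ℝ
x *ℝ y = mkℝ (λ n → seq x n ℚ.* seq y n) (*-cauchy {seq x} {seq y} (cauchy x) (cauchy y))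

------------------------------------------------------------------------
-- Complex numbers

record ℂ : Set where
  constructor _+i_
  field
    re : ℝ
    im : ℝ

open ℂ

infix 4 _≈ℂ_
_≈ℂ_ : ℂ → ℂ → Set
z ≈ℂ w = (re z ≈ℝ re w) × (im z ≈ℝ im w)

fromℤ : ℤ → ℂ
fromℤ a = fromℚ (a ℚ./ 1) +i fromℚ 0ℚ

0ℂ 1ℂ : ℂ
0ℂ = fromℤ 0ℤ
1ℂ = fromℤ 1ℤ

infixl 6 _+ℂ_
infixl 7 _*ℂ_
infixr 8 _^ℂ_

_+ℂ_ : ℂ → ℂ → ℂ
z +ℂ w = (re z +ℝ re w) +i (im z +ℝ im w)

_*ℂ_ : ℂ → ℂ → ℂ
z *ℂ w = (re z *ℝ re w -ℝ im z *ℝ im w) +i (re z *ℝ im w +ℝ im z *ℝ re w)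

_^ℂ_ : ℂ → ℕ → ℂ
z ^ℂ zero  = 1ℂ
z ^ℂ suc k = z *ℂ (z ^ℂ k)

eval : Poly → ℂ → ℂ
eval []      z = 0ℂ
eval (a ∷ p) z = fromℤ a +ℂ z *ℂ eval p z

RootOfUnity : ℂ → Set
RootOfUnity z = ∃ λ k → 1 ℕ.≤ k × z ^ℂ k ≈ℂ 1ℂ

{-# OPTIONS --safe #-}

-- Z (P_m × C_N) is computed by a transfer matrix acting on covectors over
-- the states of one row.  A word in the letters a = (1 , 0), b = (1 , 1),
-- c = (0 , 1) denotes a product covector; if its letters other than a are
-- isolated, adding a row turns a ↦ b ↦ c ↦ -a at every site.  Afterwards the
-- hard-core constraint between neighbours in the row frees the neighbours of
-- every c, and a remaining run bbb is the sum of aca and bab.  For a suitable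
-- class of words this yields ± one word of the same class, plus words in
-- which pairs of colliding domain walls have been annihilated.  Hence, modulo
-- words with fewer walls, the transfer matrix acts on finitely many words as
-- a map up to sign, so it is eventually periodic with a common period K, and
-- by induction on the number of walls some power of 1 - t^K is a denominator.
-- For even N the initial word a…a is a signed sum of words of the class,
-- because a = b - c can be used at every second site.

module Submission where

open import Defs
open import Level using (0ℓ)
open import Data.Bool using (Bool; true; false; not; _∧_; if_then_else_; T)
open import Data.Bool.Properties using (T?)
import Data.Bool.Properties as Bool
open import Data.Fin as Fin
  using (Fin; zero; suc; toℕ; fromℕ; fromℕ<; inject₁; combine; _↑ˡ_; _↑ʳ_; funToFin; finToFun)
open import Data.Fin.Permutation using (Permutation; permutation)
import Data.Fin.Properties as Fin
open import Data.Fin.Relation.Unary.Top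
  using (View; ‵fromℕ; ‵inject₁; view; view-fromℕ; view-inject₁)
open import Data.Fin.Subset as Subset using (Subset; inside; outside; _∈_; _∉_)
open import Data.Fin.Subset.Properties using (nonempty?; ∉⊥; _∈?_)
open import Data.Integer as ℤ using (ℤ; 0ℤ; 1ℤ; -1ℤ; -_; _+_; _-_; _*_)
import Data.Integer.Properties as ℤ
open import Data.Integer.Tactic.RingSolver using (solve-∀)
open import Data.List as List using (List; []; _∷_; _++_; applyUpTo; replicate)
import Data.List.Properties as List
open import Data.Nat as ℕ using (ℕ; zero; suc; _∸_; _⊔_; _!)
open import Data.Nat.Divisibility using (divides; _∣_; ∣-trans; m≤n⇒m!∣n!; m∣m*n)
import Data.Nat.Properties as ℕ
import Data.Nat.Tactic.RingSolver as ℕSolver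
open import Data.Product using (_×_; _,_; proj₁; proj₂; ∃)
open import Data.Rational as ℚ using (ℚ; 0ℚ; 1ℚ; ½; ∣_∣; positive; nonNegative)
import Data.Rational.Properties as ℚ
import Data.Rational.Unnormalised as ℚᵘ
import Data.Rational.Unnormalised.Properties as ℚᵘ
open import Data.Sum as Sum using (_⊎_; inj₁; inj₂)
open import Data.Unit using (tt)
open import Data.Vec as Vec using ([]; _∷_; lookup; tabulate)
open import Data.Vec.Functional using (updateAt)
open import Data.Vec.Functional.Properties using (updateAt-updates; updateAt-minimal)
import Data.Vec.Properties as Vec
open import Function using (_∘_; _⇔_; mk⇔; Equivalence; const)
open import Relation.Binary.PropositionalEquality
open import Relation.Nullary using (¬_; Dec; yes; no; does; _×-dec_; _→-dec_; ¬?; contradiction)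
open import Relation.Nullary.Decidable using (dec-true; dec-false; does-⇔; map′; toWitness)
open import Relation.Nullary.Decidable.Core using (dec⇒maybe)
open import Relation.Unary using (Pred; Decidable)
import Tactic.RingSolver as Solver
open import Tactic.RingSolver.Core.AlmostCommutativeRing
  using (AlmostCommutativeRing; fromCommutativeRing)

open import Algebra.Properties.CommutativeMonoid.Sum ℕ.+-0-commutativeMonoid
  using (sum; sum-permute; sum-cong-≗; ∑-distrib-+)

open SimplicialComplex
open Graph
open ≡-Reasoning

-- Indicators and sums over subsets

-- The sum over a row factors over its sites only if no row compatible with the word has two
-- adjacent occupied sites. Isolated letters guarantee this, but turning creates runs of `b`, whose
-- resolution may branch. The words `b a b a ...` and `c a c a ...` are pure phases that follow one
-- another cyclically, and walls are the defects between stretches of them. Splitting `bbb` into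
-- `aca` keeps both walls of the run, and `bab` removes both, so ordering words by their walls makes
-- the transfer matrix block triangular. A diagonal block is a signed map of a finite set, not
-- necessarily a permutation: its eigenvalues are 0 and roots of unity. The eigenvalue 0 only delays
-- periodicity and so affects the numerator alone. The coupling between blocks may create Jordan
-- blocks, which is why a power of `1 - t^K` is taken, with one factor for each possible number of
-- walls.

bit : Bool → ℤ
bit true  = 1ℤ
bit false = 0ℤ

𝟙 : ∀ {P : Set} → Dec P → ℤ
𝟙 P? = bit (does P?)

𝟙-yes : ∀ {P : Set} (P? : Dec P) → P → 𝟙 P? ≡ 1ℤ
𝟙-yes P? p = cong bit (dec-true P? p)

𝟙-no : ∀ {P : Set} (P? : Dec P) → ¬ P → 𝟙 P? ≡ 0ℤ
𝟙-no P? ¬p = cong bit (dec-false P? ¬p)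

𝟙-cong : ∀ {P Q : Set} → P ⇔ Q → (P? : Dec P) (Q? : Dec Q) → 𝟙 P? ≡ 𝟙 Q?
𝟙-cong P⇔Q P? Q? = cong bit (does-⇔ P⇔Q P? Q?)

bit-∧ : ∀ x y → bit (x ∧ y) ≡ bit x * bit y
bit-∧ true  y = sym (ℤ.*-identityˡ (bit y))
bit-∧ false y = refl

𝟙-× : ∀ {P Q : Set} (P? : Dec P) (Q? : Dec Q) → 𝟙 (P? ×-dec Q?) ≡ 𝟙 P? * 𝟙 Q?
𝟙-× P? Q? = bit-∧ (does P?) (does Q?)

𝟙-guard : ∀ {P : Set} (P? : Dec P) {x y} → (P → x ≡ y) → 𝟙 P? * x ≡ 𝟙 P? * y
𝟙-guard (yes p) x≡y = cong (1ℤ *_) (x≡y p)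
𝟙-guard (no _)  x≡y = refl

𝟙-all : ∀ {n} {P : Pred (Fin (suc n)) _} (P? : Decidable P) →
        𝟙 (Fin.all? P?) ≡ 𝟙 (P? zero) * 𝟙 (Fin.all? (P? ∘ suc))
𝟙-all P? = trans
  (𝟙-cong (mk⇔ (λ p → p zero , p ∘ suc) λ { (p , q) zero → p ; (p , q) (suc i) → q i })
          (Fin.all? P?) (P? zero ×-dec Fin.all? (P? ∘ suc)))
  (𝟙-× (P? zero) (Fin.all? (P? ∘ suc)))

-- Recursive rather than a fold over `subsets`, so that cutting a grid into rows and factoring a row
-- into sites are structural inductions.
Σₛ : ∀ n → (Subset n → ℤ) → ℤ
Σₛ zero    F = F []
Σₛ (suc n) F = Σₛ n (F ∘ (outside ∷_)) + Σₛ n (F ∘ (inside ∷_))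

Σₛ-cong : ∀ n {F G : Subset n → ℤ} → F ≗ G → Σₛ n F ≡ Σₛ n G
Σₛ-cong zero    F≗G = F≗G []
Σₛ-cong (suc n) F≗G = cong₂ _+_ (Σₛ-cong n (F≗G ∘ _)) (Σₛ-cong n (F≗G ∘ _))

Σₛ-zero : ∀ n {F : Subset n → ℤ} → (∀ σ → F σ ≡ 0ℤ) → Σₛ n F ≡ 0ℤ
Σₛ-zero zero    F≗0 = F≗0 []
Σₛ-zero (suc n) F≗0 = cong₂ _+_ (Σₛ-zero n (F≗0 ∘ _)) (Σₛ-zero n (F≗0 ∘ _))

+-interchange : ∀ a b c d → (a + b) + (c + d) ≡ (a + c) + (b + d)
+-interchange = solve-∀

Σₛ-+ : ∀ n (F G : Subset n → ℤ) → Σₛ n (λ σ → F σ + G σ) ≡ Σₛ n F + Σₛ n G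
Σₛ-+ zero    F G = refl
Σₛ-+ (suc n) F G = trans
  (cong₂ _+_ (Σₛ-+ n (F ∘ (outside ∷_)) (G ∘ (outside ∷_)))
             (Σₛ-+ n (F ∘ (inside ∷_)) (G ∘ (inside ∷_))))
  (+-interchange (Σₛ n (F ∘ (outside ∷_))) _ _ _)

Σₛ-* : ∀ n x (F : Subset n → ℤ) → Σₛ n (λ σ → x * F σ) ≡ x * Σₛ n F
Σₛ-* zero    x F = refl
Σₛ-* (suc n) x F = trans
  (cong₂ _+_ (Σₛ-* n x (F ∘ (outside ∷_))) (Σₛ-* n x (F ∘ (inside ∷_))))
  (sym (ℤ.*-distribˡ-+ x (Σₛ n (F ∘ (outside ∷_))) _))

Σₛ-swap : ∀ m n (F : Subset m → Subset n → ℤ) →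
          Σₛ m (λ σ → Σₛ n (F σ)) ≡ Σₛ n (λ τ → Σₛ m (λ σ → F σ τ))
Σₛ-swap zero    n F = refl
Σₛ-swap (suc m) n F = trans
  (cong₂ _+_ (Σₛ-swap m n (F ∘ (outside ∷_))) (Σₛ-swap m n (F ∘ (inside ∷_))))
  (sym (Σₛ-+ n _ _))

Σₛ-++ : ∀ m n (F : Subset (m ℕ.+ n) → ℤ) →
        Σₛ (m ℕ.+ n) F ≡ Σₛ m (λ σ → Σₛ n (λ τ → F (σ Vec.++ τ)))
Σₛ-++ zero    n F = refl
Σₛ-++ (suc m) n F = cong₂ _+_ (Σₛ-++ m n (F ∘ (outside ∷_))) (Σₛ-++ m n (F ∘ (inside ∷_)))

_≟ₛ_ : ∀ {n} (σ τ : Subset n) → Dec (σ ≡ τ)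
_≟ₛ_ = Vec.≡-dec Bool._≟_

Σₛ-δ : ∀ n (σ : Subset n) (F : Subset n → ℤ) → Σₛ n (λ τ → 𝟙 (σ ≟ₛ τ) * F τ) ≡ F σ
Σₛ-δ zero    []            F = ℤ.*-identityˡ (F [])
Σₛ-δ (suc n) (outside ∷ σ) F = trans
  (cong₂ _+_ (Σₛ-δ n σ (F ∘ (outside ∷_))) (Σₛ-zero n λ _ → refl))
  (ℤ.+-identityʳ _)
Σₛ-δ (suc n) (inside ∷ σ)  F = trans
  (cong₂ _+_ (Σₛ-zero n λ _ → refl) (Σₛ-δ n σ (F ∘ (inside ∷_))))
  (ℤ.+-identityˡ _)

sumℤ-++ : ∀ xs ys → sumℤ (xs ++ ys) ≡ sumℤ xs + sumℤ ys
sumℤ-++ []       ys = sym (ℤ.+-identityˡ _)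
sumℤ-++ (x ∷ xs) ys = trans (cong (x +_) (sumℤ-++ xs ys)) (sym (ℤ.+-assoc x _ _))

sumℤ-subsets : ∀ n (F : Subset n → ℤ) → sumℤ (List.map F (subsets n)) ≡ Σₛ n F
sumℤ-subsets zero    F = ℤ.+-identityʳ (F [])
sumℤ-subsets (suc n) F = begin
  sumℤ (List.map F (outs ++ ins))                      ≡⟨ cong sumℤ (List.map-++ F outs ins) ⟩
  sumℤ (List.map F outs ++ List.map F ins)             ≡⟨ sumℤ-++ (List.map F outs) _ ⟩
  sumℤ (List.map F outs) + sumℤ (List.map F ins)       ≡⟨ cong₂ _+_ (part outside) (part inside) ⟩
  Σₛ (suc n) F                                         ∎
  where
  outs = List.map (outside ∷_) (subsets n)
  ins  = List.map (inside ∷_) (subsets n)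

  part : ∀ s → sumℤ (List.map F (List.map (s ∷_) (subsets n))) ≡ Σₛ n (F ∘ (s ∷_))
  part s = trans (cong sumℤ (sym (List.map-∘ (subsets n)))) (sumℤ-subsets n (F ∘ (s ∷_)))

sumℤ-filter : ∀ {A : Set} {P : Pred A _} (P? : Decidable P) (F : A → ℤ) xs →
              sumℤ (List.map F (List.filter P? xs)) ≡ sumℤ (List.map (λ x → 𝟙 (P? x) * F x) xs)
sumℤ-filter P? F []       = refl
sumℤ-filter P? F (x ∷ xs) with does (P? x)
... | true  = cong₂ _+_ (sym (ℤ.*-identityˡ (F x))) (sumℤ-filter P? F xs)
... | false = trans (sumℤ-filter P? F xs) (sym (ℤ.+-identityˡ _))

-- The signed count of independent sets

sgn : ∀ {n} → Subset n → ℤ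
sgn σ = -1ℤ ℤ.^ Subset.∣ σ ∣

sgn-++ : ∀ {m n} (σ : Subset m) (τ : Subset n) → sgn (σ Vec.++ τ) ≡ sgn σ * sgn τ
sgn-++ []            τ = sym (ℤ.*-identityˡ (sgn τ))
sgn-++ (outside ∷ σ) τ = sgn-++ σ τ
sgn-++ (inside ∷ σ)  τ =
  trans (cong (-1ℤ *_) (sgn-++ σ τ)) (sym (ℤ.*-assoc -1ℤ (sgn σ) (sgn τ)))

sgn-⊥ : ∀ n → sgn (Subset.⊥ {n}) ≡ 1ℤ
sgn-⊥ zero    = refl
sgn-⊥ (suc n) = sgn-⊥ n

nonempty⇒suc : ∀ {n} (σ : Subset n) → Subset.Nonempty σ → ∃ λ k → Subset.∣ σ ∣ ≡ suc k
nonempty⇒suc (inside ∷ σ)  _                      = Subset.∣ σ ∣ , refl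
nonempty⇒suc (outside ∷ σ) (suc i , Vec.there i∈σ) = nonempty⇒suc σ (i , i∈σ)

empty⇒⊥ : ∀ {n} (σ : Subset n) → ¬ Subset.Nonempty σ → Subset.⊥ ≡ σ
empty⇒⊥ []            _ = refl
empty⇒⊥ (inside ∷ σ)  e = contradiction (zero , Vec.here) e
empty⇒⊥ (outside ∷ σ) e = cong (outside ∷_) (empty⇒⊥ σ λ (i , i∈σ) → e (suc i , Vec.there i∈σ))

-- A nonempty simplex has dimension one less than its cardinality, so the minus sign before `χ`
-- corrects its sign, and the leading 1 is the term of the empty simplex.
signed-simplex-count : ∀ {n} (X : SimplicialComplex n) →
  1ℤ - χ X ≡ Σₛ n (λ σ → 𝟙 (simplex? X σ) * sgn σ)
signed-simplex-count {n} X = sym (begin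
  Σₛ n (λ σ → 𝟙 (simplex? X σ) * sgn σ)      ≡⟨ Σₛ-cong n split ⟩
  Σₛ n (λ σ → δ σ * 1ℤ + -1ℤ * term σ)       ≡⟨ Σₛ-+ n _ _ ⟩
  Σₛ n (λ σ → δ σ * 1ℤ) + Σₛ n (λ σ → -1ℤ * term σ)
    ≡⟨ cong₂ _+_ (Σₛ-δ n Subset.⊥ (λ _ → 1ℤ)) (Σₛ-* n -1ℤ term) ⟩
  1ℤ + -1ℤ * Σₛ n term                       ≡⟨ cong (λ x → 1ℤ + -1ℤ * x) Σterm ⟩
  1ℤ + -1ℤ * χ X                             ≡⟨ cong (1ℤ +_) (ℤ.-1*i≡-i (χ X)) ⟩
  1ℤ - χ X                                   ∎)
  where
  δ term : Subset n → ℤ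
  δ σ    = 𝟙 (Subset.⊥ ≟ₛ σ)
  term σ = 𝟙 (nonempty? σ ×-dec simplex? X σ) * -1ℤ ℤ.^ dim σ

  Σterm : Σₛ n term ≡ χ X
  Σterm = sym (trans (sumℤ-filter (λ σ → nonempty? σ ×-dec simplex? X σ) _ (subsets n))
                     (sumℤ-subsets n term))

  flip-sign : ∀ x y → x * (-1ℤ * y) ≡ 0ℤ * 1ℤ + -1ℤ * (x * y)
  flip-sign = solve-∀

  split : ∀ σ → 𝟙 (simplex? X σ) * sgn σ ≡ δ σ * 1ℤ + -1ℤ * term σ
  split σ with nonempty? σ
  ... | yes ne@(i , i∈σ) with nonempty⇒suc σ ne
  ...   | k , ∣σ∣≡1+k rewrite 𝟙-no (Subset.⊥ ≟ₛ σ) (λ { refl → ∉⊥ i∈σ }) | ∣σ∣≡1+k =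
    flip-sign (𝟙 (simplex? X σ)) (-1ℤ ℤ.^ k)
  split σ | no e with empty⇒⊥ σ e
  ... | refl rewrite 𝟙-yes (simplex? X Subset.⊥) (empty X)
                   | 𝟙-yes (Subset.⊥ {n} ≟ₛ Subset.⊥) refl
                   | sgn-⊥ n = refl

-- The transfer matrix along the path

Disjoint : ∀ {n} → Subset n → Subset n → Set
Disjoint ρ τ = ∀ v → ¬ (v ∈ ρ × v ∈ τ)

disjoint? : ∀ {n} (ρ τ : Subset n) → Dec (Disjoint ρ τ)
disjoint? ρ τ = Fin.all? λ v → ¬? ((v ∈? ρ) ×-dec (v ∈? τ))

indep? : ∀ H (τ : Subset (order H)) → Dec (Independent H τ)
indep? H = simplex? (Ind H)

-- The signed count of independent sets of `path m □ H` that can follow a row `ρ`, written as `m`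
-- applications of the transfer matrix to the all-ones vector.
count : (H : Graph) → ℕ → Subset (order H) → ℤ
count H zero    ρ = 1ℤ
count H (suc m) ρ =
  Σₛ (order H) λ τ → 𝟙 (disjoint? ρ τ) * (𝟙 (indep? H τ) * (sgn τ * count H m τ))

module _ (H : Graph) where
  private
    N = order H

  PairIndependent : ∀ {m} → Subset (m ℕ.* N) → Set
  PairIndependent {m} σ = ∀ (u u′ : Fin m) v v′ → combine u v ∈ σ → combine u′ v′ ∈ σ →
    ¬ ((u ≡ u′ × Adj H v v′) ⊎ (v ≡ v′ × Adj (path m) u u′))

  independent⇒pair : ∀ {m} {σ : Subset (m ℕ.* N)} → Independent (path m □ H) σ → PairIndependent {m} σ
  independent⇒pair {m} ind u u′ v v′ uv∈ uv′∈ =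
    subst₂ (λ (u , v) (u′ , v′) → ¬ ((u ≡ u′ × Adj H v v′) ⊎ (v ≡ v′ × Adj (path m) u u′)))
      (Fin.remQuot-combine u v) (Fin.remQuot-combine u′ v′)
      (ind (combine u v) (combine u′ v′) uv∈ uv′∈)

  pair⇒independent : ∀ {m} {σ : Subset (m ℕ.* N)} → PairIndependent {m} σ → Independent (path m □ H) σ
  pair⇒independent {m} {σ} ind x y x∈σ y∈σ = ind _ _ _ _
    (subst (_∈ σ) (sym (Fin.combine-remQuot {m} N x)) x∈σ)
    (subst (_∈ σ) (sym (Fin.combine-remQuot {m} N y)) y∈σ)

  -- The first row is singled out by `toℕ u ≡ 0` because `Fin m` contains `zero` only for a
  -- successor `m`.
  Avoids : ∀ m → Subset N → Subset (m ℕ.* N) → Set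
  Avoids m ρ σ = ∀ (u : Fin m) v → toℕ u ≡ 0 → ¬ (v ∈ ρ × combine u v ∈ σ)

  avoids? : ∀ m ρ σ → Dec (Avoids m ρ σ)
  avoids? m ρ σ = Fin.all? λ u → Fin.all? λ v →
    (toℕ u ℕ.≟ 0) →-dec ¬? ((v ∈? ρ) ×-dec (combine u v ∈? σ))

  Admissible : ∀ m → Subset N → Subset (m ℕ.* N) → Set
  Admissible m ρ σ = Independent (path m □ H) σ × Avoids m ρ σ

  admissible? : ∀ m ρ σ → Dec (Admissible m ρ σ)
  admissible? m ρ σ = indep? (path m □ H) σ ×-dec avoids? m ρ σ

  module _ {m} (τ : Subset N) (σ : Subset (m ℕ.* N)) where
    first⁺ : ∀ {v} → v ∈ τ → (v ↑ˡ (m ℕ.* N)) ∈ (τ Vec.++ σ)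
    first⁺ {v} v∈τ = Vec.lookup⇒[]= _ _ (trans (Vec.lookup-++ˡ τ σ v) (Vec.[]=⇒lookup v∈τ))

    first⁻ : ∀ {v} → (v ↑ˡ (m ℕ.* N)) ∈ (τ Vec.++ σ) → v ∈ τ
    first⁻ {v} v∈ = Vec.lookup⇒[]= _ _ (trans (sym (Vec.lookup-++ˡ τ σ v)) (Vec.[]=⇒lookup v∈))

    rest⁺ : ∀ {x} → x ∈ σ → (N ↑ʳ x) ∈ (τ Vec.++ σ)
    rest⁺ {x} x∈σ = Vec.lookup⇒[]= _ _ (trans (Vec.lookup-++ʳ τ σ x) (Vec.[]=⇒lookup x∈σ))

    rest⁻ : ∀ {x} → (N ↑ʳ x) ∈ (τ Vec.++ σ) → x ∈ σ
    rest⁻ {x} x∈ = Vec.lookup⇒[]= _ _ (trans (sym (Vec.lookup-++ʳ τ σ x)) (Vec.[]=⇒lookup x∈))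

    -- `combine zero v` lies in the first block of `N` entries and `combine (suc u) v` is a shift of
    -- `combine u v`. The only edges from the first row to the others join equal sites of the first
    -- two rows, so `τ` acts on `σ` exactly as `ρ` acts on `τ`.
    admissible-++ : ∀ ρ → Admissible (suc m) ρ (τ Vec.++ σ) ⇔
                          (Disjoint ρ τ × Independent H τ × Admissible m τ σ)
    admissible-++ ρ = mk⇔ to from
      where
      to : Admissible (suc m) ρ (τ Vec.++ σ) → Disjoint ρ τ × Independent H τ × Admissible m τ σ
      to (ind , av) =
          (λ v (v∈ρ , v∈τ) → av zero v refl (v∈ρ , first⁺ v∈τ))
        , (λ v v′ v∈τ v′∈τ adj → pairs zero zero v v′ (first⁺ v∈τ) (first⁺ v′∈τ) (inj₁ (refl , adj)))
        , pair⇒independent (λ u u′ v v′ uv∈σ uv′∈σ adj →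
            pairs (suc u) (suc u′) v v′ (rest⁺ uv∈σ) (rest⁺ uv′∈σ)
              (Sum.map (λ (e , a) → cong suc e , a) (λ (e , a) → e , Sum.map (cong suc) (cong suc) a) adj))
        , λ u v u≡0 (v∈τ , uv∈σ) → pairs zero (suc u) v v (first⁺ v∈τ) (rest⁺ uv∈σ)
            (inj₂ (refl , inj₁ (cong suc (sym u≡0))))
        where pairs = independent⇒pair {suc m} ind

      from : Disjoint ρ τ × Independent H τ × Admissible m τ σ → Admissible (suc m) ρ (τ Vec.++ σ)
      from (disj , indτ , indσ , av) = pair⇒independent {suc m} pairs , avoids
        where
        avoids : Avoids (suc m) ρ (τ Vec.++ σ)
        avoids zero v _ (v∈ρ , v∈) = disj v (v∈ρ , first⁻ v∈)

        pairs : PairIndependent {suc m} (τ Vec.++ σ)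
        pairs zero    zero     v v′ v∈ v′∈ (inj₁ (_ , adj)) = indτ v v′ (first⁻ v∈) (first⁻ v′∈) adj
        pairs zero    zero     v v′ v∈ v′∈ (inj₂ (_ , inj₁ ()))
        pairs zero    zero     v v′ v∈ v′∈ (inj₂ (_ , inj₂ ()))
        pairs zero    (suc u′) v _ v∈ uv′∈ (inj₂ (refl , inj₁ 1≡1+u′)) =
          av u′ v (sym (ℕ.suc-injective 1≡1+u′)) (first⁻ v∈ , rest⁻ uv′∈)
        pairs (suc u) zero     v _ uv∈ v∈ (inj₂ (refl , inj₂ 1≡1+u)) =
          av u v (sym (ℕ.suc-injective 1≡1+u)) (first⁻ v∈ , rest⁻ uv∈)
        pairs (suc u) (suc u′) v v′ uv∈ uv′∈ adj =
          independent⇒pair {m} indσ u u′ v v′ (rest⁻ uv∈) (rest⁻ uv′∈)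
            (Sum.map (λ (e , a) → Fin.suc-injective e , a)
                     (λ (e , a) → e , Sum.map ℕ.suc-injective ℕ.suc-injective a) adj)

  private
    regroup : ∀ a b c d e → (a * (b * c)) * (d * e) ≡ a * (b * (d * (c * e)))
    regroup = solve-∀

  admissible-count : ∀ m ρ → Σₛ (m ℕ.* N) (λ σ → 𝟙 (admissible? m ρ σ) * sgn σ) ≡ count H m ρ
  admissible-count zero ρ =
    cong (_* 1ℤ) (𝟙-yes (admissible? zero ρ []) ((λ ()) , λ ()))
  admissible-count (suc m) ρ = trans (Σₛ-++ N (m ℕ.* N) _) (Σₛ-cong N step)
    where
    step : ∀ τ → Σₛ (m ℕ.* N) (λ σ → 𝟙 (admissible? (suc m) ρ (τ Vec.++ σ)) * sgn (τ Vec.++ σ)) ≡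
                 𝟙 (disjoint? ρ τ) * (𝟙 (indep? H τ) * (sgn τ * count H m τ))
    step τ = begin
      Σₛ (m ℕ.* N) (λ σ → 𝟙 (admissible? (suc m) ρ (τ Vec.++ σ)) * sgn (τ Vec.++ σ))
        ≡⟨ Σₛ-cong (m ℕ.* N) summand ⟩
      Σₛ (m ℕ.* N) (λ σ → δ * (ι * (sgn τ * (𝟙 (admissible? m τ σ) * sgn σ))))
        ≡⟨ Σₛ-* (m ℕ.* N) δ _ ⟩
      δ * Σₛ (m ℕ.* N) (λ σ → ι * (sgn τ * (𝟙 (admissible? m τ σ) * sgn σ)))
        ≡⟨ cong (δ *_) (Σₛ-* (m ℕ.* N) ι _) ⟩
      δ * (ι * Σₛ (m ℕ.* N) (λ σ → sgn τ * (𝟙 (admissible? m τ σ) * sgn σ)))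
        ≡⟨ cong (λ x → δ * (ι * x)) (trans (Σₛ-* (m ℕ.* N) (sgn τ) _)
             (cong (sgn τ *_) (admissible-count m τ))) ⟩
      δ * (ι * (sgn τ * count H m τ)) ∎
      where
      δ = 𝟙 (disjoint? ρ τ)
      ι = 𝟙 (indep? H τ)

      summand : ∀ σ → 𝟙 (admissible? (suc m) ρ (τ Vec.++ σ)) * sgn (τ Vec.++ σ) ≡
                      δ * (ι * (sgn τ * (𝟙 (admissible? m τ σ) * sgn σ)))
      summand σ = trans
        (cong₂ _*_
          (trans
            (𝟙-cong (admissible-++ τ σ ρ) (admissible? (suc m) ρ (τ Vec.++ σ))
              (disjoint? ρ τ ×-dec (indep? H τ ×-dec admissible? m τ σ)))
            (trans (𝟙-× (disjoint? ρ τ) (indep? H τ ×-dec admissible? m τ σ))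
              (cong (δ *_) (𝟙-× (indep? H τ) (admissible? m τ σ)))))
          (sgn-++ τ σ))
        (regroup δ ι _ (sgn τ) (sgn σ))

  Z-path□ : ∀ m → Z (path m □ H) ≡ count H m Subset.⊥
  Z-path□ m = begin
    Z (path m □ H)
      ≡⟨ signed-simplex-count (Ind (path m □ H)) ⟩
    Σₛ (m ℕ.* N) (λ σ → 𝟙 (indep? (path m □ H) σ) * sgn σ)
      ≡⟨ Σₛ-cong (m ℕ.* N) (λ σ → cong (_* sgn σ) (𝟙-cong avoids-⊥
           (indep? (path m □ H) σ) (admissible? m Subset.⊥ σ))) ⟩
    Σₛ (m ℕ.* N) (λ σ → 𝟙 (admissible? m Subset.⊥ σ) * sgn σ)
      ≡⟨ admissible-count m Subset.⊥ ⟩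
    count H m Subset.⊥ ∎
    where
    avoids-⊥ : ∀ {σ} → Independent (path m □ H) σ ⇔ Admissible m Subset.⊥ σ
    avoids-⊥ = mk⇔ (λ ind → ind , λ _ _ _ (v∈⊥ , _) → ∉⊥ v∈⊥) proj₁

-- Words

Letter : Set
Letter = Fin 3

pattern a = zero
pattern b = suc zero
pattern c = suc (suc zero)

is : Letter → Letter → Bool
is p x = does (p Fin.≟ x)

-- The condition on the window v l x r z around x: letters other than a are
-- isolated, and the runs of a between two of them have length 1 for b…b,
-- 1 or 2 for b…c and c…b, 1 or 3 for c…c.
allowed : (v l x r z : Letter) → Bool
allowed _ l b r _ = is a l ∧ is a r
allowed _ l c r _ = is a l ∧ is a r
allowed v a a a z = is c v ∧ is c z
allowed v a a b z = is c v
allowed v a a c z = not (is c v)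
allowed v b a a z = is c z
allowed v c a a z = not (is c z)
allowed _ _ a _ _ = true

-- The new letter at x: all letters turn a ↦ b ↦ c ↦ a, the neighbours of a
-- new c are freed, and the remaining run bbb (from c a a a c) is replaced by
-- aca, or by bab if the choice k at its middle is true.
evolve : (v l x r z : Letter) (k₋ k k₊ : Bool) → Letter
evolve _ _ b _ _ _  _ _  = c
evolve _ _ c _ _ _  _ _  = a
evolve _ a a a _ _  k _  = if k then a else c
evolve v a a c _ k₋ _ _  = if is a v then (if k₋ then b else a) else b
evolve _ c a a z _  _ k₊ = if is a z then (if k₊ then b else a) else b
evolve _ c a c _ _  _ _  = b
evolve _ _ a _ _ _  _ _  = a

match : (p q s l x r : Letter) → ℕ
match p q s l x r = if is p l ∧ is q x ∧ is s r then 1 else 0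

-- There is one domain wall in each of the runs b a c, c a b, b a a c, c a a b,
-- and there are two in c a a a c.
density : (l x r : Letter) → ℕ
density l x r =
  match b a a l x r ℕ.+ match a a b l x r ℕ.+ match b a c l x r ℕ.+ match c a b l x r ℕ.+
  2 ℕ.* match a a a l x r

-- Each stands for half of the weight 2 that `density` gives to a middle: a kept middle sends one
-- wall to either side, a lost one has its two walls annihilated.
kept lost : (l x r : Letter) → Bool → ℕ
kept l x r k = if k then 0 else match a a a l x r
lost l x r k = if k then match a a a l x r else 0

∀ᵇ : ∀ {P : Bool → Set} → Decidable P → Dec (∀ x → P x)
∀ᵇ P? = map′ (λ { (p , q) true → p ; (p , q) false → q }) (λ p → p true , p false)
             (P? true ×-dec P? false)

∀ˡ : ∀ {P : Letter → Set} → Decidable P → Dec (∀ x → P x)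
∀ˡ = Fin.all?

-- A new letter depends on five old ones, so a window of five new letters depends on nine. The proof
-- is an exhaustive check; each hypothesis comes right after the last letter that it mentions, so
-- that a forbidden window is discarded before the next letter is enumerated.
evolve-allowed : ∀ x₁ x₂ x₃ x₄ x₅ → T (allowed x₁ x₂ x₃ x₄ x₅) →
  ∀ x₆ → T (allowed x₂ x₃ x₄ x₅ x₆) → ∀ x₇ → T (allowed x₃ x₄ x₅ x₆ x₇) →
  ∀ x₈ → T (allowed x₄ x₅ x₆ x₇ x₈) → ∀ x₉ → T (allowed x₅ x₆ x₇ x₈ x₉) →
  ∀ k₁ k₂ k₃ k₄ k₅ k₆ k₇ → T (allowed
    (evolve x₁ x₂ x₃ x₄ x₅ k₁ k₂ k₃) (evolve x₂ x₃ x₄ x₅ x₆ k₂ k₃ k₄)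
    (evolve x₃ x₄ x₅ x₆ x₇ k₃ k₄ k₅) (evolve x₄ x₅ x₆ x₇ x₈ k₄ k₅ k₆)
    (evolve x₅ x₆ x₇ x₈ x₉ k₅ k₆ k₇))
evolve-allowed = toWitness {a? =
  ∀ˡ λ x₁ → ∀ˡ λ x₂ → ∀ˡ λ x₃ → ∀ˡ λ x₄ → ∀ˡ λ x₅ → T? (allowed x₁ x₂ x₃ x₄ x₅) →-dec
  (∀ˡ λ x₆ → T? (allowed x₂ x₃ x₄ x₅ x₆) →-dec (∀ˡ λ x₇ → T? (allowed x₃ x₄ x₅ x₆ x₇) →-dec
  (∀ˡ λ x₈ → T? (allowed x₄ x₅ x₆ x₇ x₈) →-dec (∀ˡ λ x₉ → T? (allowed x₅ x₆ x₇ x₈ x₉) →-dec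
  (∀ᵇ λ k₁ → ∀ᵇ λ k₂ → ∀ᵇ λ k₃ → ∀ᵇ λ k₄ → ∀ᵇ λ k₅ →
   ∀ᵇ λ k₆ → ∀ᵇ λ k₇ → T? (allowed
    (evolve x₁ x₂ x₃ x₄ x₅ k₁ k₂ k₃) (evolve x₂ x₃ x₄ x₅ x₆ k₂ k₃ k₄)
    (evolve x₃ x₄ x₅ x₆ x₇ k₃ k₄ k₅) (evolve x₄ x₅ x₆ x₇ x₈ k₄ k₅ k₆)
    (evolve x₅ x₆ x₇ x₈ x₉ k₅ k₆ k₇)))))))} _

-- The walls of a run b a a c or c a a b stay inside the run, those of b a c
-- and c a b move by one site and those of c a a a c by two, unless they
-- annihilate each other.
evolve-density : ∀ x₁ x₂ x₃ x₄ x₅ → T (allowed x₁ x₂ x₃ x₄ x₅) →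
  ∀ x₆ → T (allowed x₂ x₃ x₄ x₅ x₆) → ∀ x₇ → T (allowed x₃ x₄ x₅ x₆ x₇) →
  ∀ k₁ k₂ k₃ k₄ k₅ →
  density (evolve x₁ x₂ x₃ x₄ x₅ k₁ k₂ k₃) (evolve x₂ x₃ x₄ x₅ x₆ k₂ k₃ k₄)
          (evolve x₃ x₄ x₅ x₆ x₇ k₃ k₄ k₅) ≡
  match b a a x₃ x₄ x₅ ℕ.+ match a a b x₃ x₄ x₅ ℕ.+ match b a c x₂ x₃ x₄ ℕ.+ match c a b x₄ x₅ x₆ ℕ.+
  (kept x₁ x₂ x₃ k₁ ℕ.+ kept x₅ x₆ x₇ k₅)
evolve-density = toWitness {a? =
  ∀ˡ λ x₁ → ∀ˡ λ x₂ → ∀ˡ λ x₃ → ∀ˡ λ x₄ → ∀ˡ λ x₅ → T? (allowed x₁ x₂ x₃ x₄ x₅) →-dec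
  (∀ˡ λ x₆ → T? (allowed x₂ x₃ x₄ x₅ x₆) →-dec (∀ˡ λ x₇ → T? (allowed x₃ x₄ x₅ x₆ x₇) →-dec
  (∀ᵇ λ k₁ → ∀ᵇ λ k₂ → ∀ᵇ λ k₃ → ∀ᵇ λ k₄ → ∀ᵇ λ k₅ →
  density (evolve x₁ x₂ x₃ x₄ x₅ k₁ k₂ k₃) (evolve x₂ x₃ x₄ x₅ x₆ k₂ k₃ k₄)
          (evolve x₃ x₄ x₅ x₆ x₇ k₃ k₄ k₅) ℕ.≟
  match b a a x₃ x₄ x₅ ℕ.+ match a a b x₃ x₄ x₅ ℕ.+ match b a c x₂ x₃ x₄ ℕ.+ match c a b x₄ x₅ x₆ ℕ.+
  (kept x₁ x₂ x₃ k₁ ℕ.+ kept x₅ x₆ x₇ k₅))))} _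

-- Covectors of words

Word : ℕ → Set
Word n = Fin n → Letter

-- The letters are the covectors a = (1 , 0), b = (1 , 1), c = (0 , 1)
-- over the two states (free, occupied) of a site.
allows : Letter → Bool → Bool
allows a s = not s
allows b _ = true
allows c s = s

Compatible : ∀ {n} → Word n → Subset n → Set
Compatible w τ = ∀ i → T (allows (w i) (lookup τ i))

compatible? : ∀ {n} (w : Word n) τ → Dec (Compatible w τ)
compatible? w τ = Fin.all? λ i → T? (allows (w i) (lookup τ i))

turn : Letter → Letter
turn a = b
turn b = c
turn c = a

turnSign : Letter → ℤ
turnSign c = -1ℤ
turnSign _ = 1ℤ

wordSign : ∀ {n} → Word n → ℤ
wordSign {zero}  w = 1ℤ
wordSign {suc n} w = turnSign (w zero) * wordSign (w ∘ suc)

turnSign² : ∀ x → turnSign x * turnSign x ≡ 1ℤ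
turnSign² a = refl
turnSign² b = refl
turnSign² c = refl

wordSign² : ∀ {n} (w : Word n) → wordSign w * wordSign w ≡ 1ℤ
wordSign² {zero}  w = refl
wordSign² {suc n} w = trans (regroup (turnSign (w zero)) (wordSign (w ∘ suc)))
  (cong₂ _*_ (turnSign² (w zero)) (wordSign² (w ∘ suc)))
  where
  regroup : ∀ x y → (x * y) * (x * y) ≡ (x * x) * (y * y)
  regroup = solve-∀

private
  disjoint-bit : Bool → Bool → ℤ
  disjoint-bit s t = bit (not (s ∧ t))

  disjoint-∷ : ∀ {n} s t (ρ τ : Subset n) →
    𝟙 (disjoint? (s ∷ ρ) (t ∷ τ)) ≡ disjoint-bit s t * 𝟙 (disjoint? ρ τ)
  disjoint-∷ s t ρ τ = trans
    (𝟙-cong (mk⇔ to from) (disjoint? (s ∷ ρ) (t ∷ τ)) (T? (not (s ∧ t)) ×-dec disjoint? ρ τ))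
    (𝟙-× (T? (not (s ∧ t))) (disjoint? ρ τ))
    where
    to : Disjoint (s ∷ ρ) (t ∷ τ) → T (not (s ∧ t)) × Disjoint ρ τ
    to d = head s t (d zero) , λ v (v∈ρ , v∈τ) → d (suc v) (Vec.there v∈ρ , Vec.there v∈τ)
      where
      head : ∀ s t → ¬ (zero ∈ (s ∷ ρ) × zero ∈ (t ∷ τ)) → T (not (s ∧ t))
      head true  true  d = contradiction (Vec.here , Vec.here) d
      head true  false d = tt
      head false t     d = tt

    from : T (not (s ∧ t)) × Disjoint ρ τ → Disjoint (s ∷ ρ) (t ∷ τ)
    from (p , d) zero    (Vec.here , Vec.here)          = p
    from (p , d) (suc v) (Vec.there v∈ρ , Vec.there v∈τ) = d v (v∈ρ , v∈τ)

  compatible-∷ : ∀ {n} (w : Word (suc n)) s τ →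
    𝟙 (compatible? w (s ∷ τ)) ≡ bit (allows (w zero) s) * 𝟙 (compatible? (w ∘ suc) τ)
  compatible-∷ w s τ = 𝟙-all λ i → T? (allows (w i) (lookup (s ∷ τ) i))

-- Sign, compatibility and disjointness are all products over the sites. At one site the sum is the
-- linear map (x , y) ↦ (x - y , x), whose cube is -1; `a`, `b`, `c` are three successive points of
-- one of its orbits.
row-sum : ∀ {n} (w : Word n) (τ : Subset n) →
  Σₛ n (λ ρ → 𝟙 (compatible? w ρ) * sgn ρ * 𝟙 (disjoint? ρ τ)) ≡
  wordSign w * 𝟙 (compatible? (turn ∘ w) τ)
row-sum {zero}  w []      = refl
row-sum {suc n} w (t ∷ τ) = begin
  Σₛ n (λ ρ → 𝟙 (compatible? w (outside ∷ ρ)) * sgn ρ * 𝟙 (disjoint? (outside ∷ ρ) (t ∷ τ))) +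
  Σₛ n (λ ρ → 𝟙 (compatible? w (inside ∷ ρ)) * (-1ℤ * sgn ρ) * 𝟙 (disjoint? (inside ∷ ρ) (t ∷ τ)))
    ≡⟨ cong₂ _+_
         (factor outside 1ℤ sgn (λ ρ → sym (ℤ.*-identityˡ (sgn ρ))))
         (factor inside -1ℤ (λ ρ → -1ℤ * sgn ρ) (λ _ → refl)) ⟩
  coef outside 1ℤ * rest + coef inside -1ℤ * rest
    ≡⟨ sym (ℤ.*-distribʳ-+ rest (coef outside 1ℤ) (coef inside -1ℤ)) ⟩
  (coef outside 1ℤ + coef inside -1ℤ) * rest
    ≡⟨ cong₂ _*_ (site (w zero) t) (row-sum (w ∘ suc) τ) ⟩
  (turnSign (w zero) * bit (allows (turn (w zero)) t)) *
  (wordSign (w ∘ suc) * 𝟙 (compatible? (turn ∘ w ∘ suc) τ))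
    ≡⟨ regroup′ (turnSign (w zero)) _ _ _ ⟩
  wordSign w * (bit (allows (turn (w zero)) t) * 𝟙 (compatible? (turn ∘ w ∘ suc) τ))
    ≡⟨ cong (wordSign w *_) (sym (compatible-∷ (turn ∘ w) t τ)) ⟩
  wordSign w * 𝟙 (compatible? (turn ∘ w) (t ∷ τ)) ∎
  where
  rest : ℤ
  rest = Σₛ n (λ ρ → 𝟙 (compatible? (w ∘ suc) ρ) * sgn ρ * 𝟙 (disjoint? ρ τ))

  coef : Bool → ℤ → ℤ
  coef s ε = bit (allows (w zero) s) * ε * disjoint-bit s t

  regroup : ∀ u v ε x y z → (u * x) * (ε * y) * (v * z) ≡ (u * ε * v) * (x * y * z)
  regroup = solve-∀

  regroup′ : ∀ x y z u → (x * y) * (z * u) ≡ (x * z) * (y * u)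
  regroup′ = solve-∀

  factor : ∀ s ε (sg : Subset n → ℤ) → (∀ ρ → sg ρ ≡ ε * sgn ρ) →
    Σₛ n (λ ρ → 𝟙 (compatible? w (s ∷ ρ)) * sg ρ * 𝟙 (disjoint? (s ∷ ρ) (t ∷ τ))) ≡ coef s ε * rest
  factor s ε sg sg≡ = trans
    (Σₛ-cong n λ ρ → trans
      (cong₂ _*_ (cong₂ _*_ (compatible-∷ w s ρ) (sg≡ ρ)) (disjoint-∷ s t ρ τ))
      (regroup (bit (allows (w zero) s)) (disjoint-bit s t) ε _ (sgn ρ) _))
    (Σₛ-* n (coef s ε) _)

  site : ∀ x t → bit (allows x outside) * 1ℤ * disjoint-bit outside t +
                 bit (allows x inside) * -1ℤ * disjoint-bit inside t ≡
                 turnSign x * bit (allows (turn x) t)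
  site a true  = refl
  site a false = refl
  site b true  = refl
  site b false = refl
  site c true  = refl
  site c false = refl

-- The transfer matrix on product covectors

module _ (H : Graph) where
  private
    N = order H

  weight : ℕ → Subset N → ℤ
  weight m τ = 𝟙 (indep? H τ) * (sgn τ * count H m τ)

  -- The row constrained by `w` is not counted in `m`: it is followed by `m` further rows.
  wordCount : Word N → ℕ → ℤ
  wordCount w m = Σₛ N λ τ → 𝟙 (compatible? w τ) * weight m τ

  wordCount-cong : ∀ {w w′ : Word N} → w ≗ w′ → ∀ m → wordCount w m ≡ wordCount w′ m
  wordCount-cong {w} {w′} w≗w′ m = Σₛ-cong N λ τ → cong (_* weight m τ)
    (𝟙-cong (mk⇔ (λ p i → subst (λ x → T (allows x (lookup τ i))) (w≗w′ i) (p i))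
                 (λ p i → subst (λ x → T (allows x (lookup τ i))) (sym (w≗w′ i)) (p i)))
            (compatible? w τ) (compatible? w′ τ))

  -- The letters `a` force their row to be empty, and an empty row puts no constraint on the `m`
  -- rows after it.
  Z≡wordCount : ∀ m → Z (path m □ H) ≡ wordCount (λ _ → a) m
  Z≡wordCount m = trans (Z-path□ H m) (sym (begin
    wordCount (λ _ → a) m
      ≡⟨ Σₛ-cong N (λ τ → cong (_* weight m τ)
           (𝟙-cong (only-⊥ τ) (compatible? (λ _ → a) τ) (Subset.⊥ ≟ₛ τ))) ⟩
    Σₛ N (λ τ → 𝟙 (Subset.⊥ ≟ₛ τ) * weight m τ)
      ≡⟨ Σₛ-δ N Subset.⊥ (weight m) ⟩
    weight m Subset.⊥
      ≡⟨ cong₂ (λ x y → x * (y * count H m Subset.⊥))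
           (𝟙-yes (indep? H Subset.⊥) (empty (Ind H))) (sgn-⊥ N) ⟩
    1ℤ * (1ℤ * count H m Subset.⊥)
      ≡⟨ trans (ℤ.*-identityˡ _) (ℤ.*-identityˡ _) ⟩
    count H m Subset.⊥ ∎))
    where
    only-⊥ : ∀ {n} (τ : Subset n) → Compatible (λ _ → a) τ ⇔ (Subset.⊥ ≡ τ)
    only-⊥ τ = mk⇔ (to τ) λ { refl i → subst (T ∘ not) (sym (Vec.lookup-replicate i outside)) tt }
      where
      to : ∀ {n} (τ : Subset n) → Compatible (λ _ → a) τ → Subset.⊥ ≡ τ
      to []            _ = refl
      to (outside ∷ τ) p = cong (outside ∷_) (to τ (p ∘ suc))
      to (inside ∷ τ)  p = contradiction (p zero) λ ()

  -- The hypothesis makes the indicator of independence equal to 1 on all rows in the sum. What then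
  -- remains of the sum over `ρ` is the product that `row-sum` evaluates.
  wordCount-turn : ∀ (w : Word N) → (∀ τ → Compatible w τ → Independent H τ) →
    ∀ m → wordCount w (suc m) ≡ wordSign w * wordCount (turn ∘ w) m
  wordCount-turn w ind m = begin
    Σₛ N (λ ρ → 𝟙 (compatible? w ρ) * weight (suc m) ρ)
      ≡⟨ Σₛ-cong N (λ ρ → trans (drop-indep ρ)
           (sym (Σₛ-* N (𝟙 (compatible? w ρ) * sgn ρ) λ τ → 𝟙 (disjoint? ρ τ) * weight m τ))) ⟩
    Σₛ N (λ ρ → Σₛ N λ τ → 𝟙 (compatible? w ρ) * sgn ρ * (𝟙 (disjoint? ρ τ) * weight m τ))
      ≡⟨ Σₛ-swap N N _ ⟩
    Σₛ N (λ τ → Σₛ N λ ρ → 𝟙 (compatible? w ρ) * sgn ρ * (𝟙 (disjoint? ρ τ) * weight m τ))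
      ≡⟨ Σₛ-cong N (λ τ → trans
           (Σₛ-cong N λ ρ → regroup (𝟙 (compatible? w ρ) * sgn ρ) (𝟙 (disjoint? ρ τ)) (weight m τ))
           (Σₛ-* N (weight m τ) λ ρ → 𝟙 (compatible? w ρ) * sgn ρ * 𝟙 (disjoint? ρ τ))) ⟩
    Σₛ N (λ τ → weight m τ * Σₛ N λ ρ → 𝟙 (compatible? w ρ) * sgn ρ * 𝟙 (disjoint? ρ τ))
      ≡⟨ Σₛ-cong N (λ τ → trans (cong (weight m τ *_) (row-sum w τ))
                                (regroup′ (weight m τ) (wordSign w) (𝟙 (compatible? (turn ∘ w) τ)))) ⟩
    Σₛ N (λ τ → wordSign w * (𝟙 (compatible? (turn ∘ w) τ) * weight m τ))
      ≡⟨ Σₛ-* N (wordSign w) (λ τ → 𝟙 (compatible? (turn ∘ w) τ) * weight m τ) ⟩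
    wordSign w * wordCount (turn ∘ w) m ∎
    where
    regroup : ∀ x y z → x * (y * z) ≡ z * (x * y)
    regroup = solve-∀

    regroup′ : ∀ x y z → x * (y * z) ≡ y * (z * x)
    regroup′ = solve-∀

    reassoc : ∀ x y z → x * (1ℤ * (y * z)) ≡ x * y * z
    reassoc = solve-∀

    drop-indep : ∀ ρ → 𝟙 (compatible? w ρ) * weight (suc m) ρ ≡
                       𝟙 (compatible? w ρ) * sgn ρ * count H (suc m) ρ
    drop-indep ρ = trans
      (𝟙-guard (compatible? w ρ) λ p → cong (_* (sgn ρ * count H (suc m) ρ)) (𝟙-yes (indep? H ρ) (ind ρ p)))
      (reassoc (𝟙 (compatible? w ρ)) (sgn ρ) (count H (suc m) ρ))

-- Imposing the hard-core constraint, one site at a time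

middle : (l x r : Letter) → Bool
middle l x r = is a l ∧ is a x ∧ is a r

-- An old `b` has turned into `c`, so its site is occupied and the neighbours are free. At a middle,
-- the choice bit records whether the site is free; if it is occupied, it frees its neighbours in
-- turn.
expand-to : ∀ v l x r z s t u →
  T (allows (turn l) s) → T (allows (turn x) t) → T (allows (turn r) u) →
  T (not (s ∧ t)) → T (not (t ∧ u)) →
  T (allows (evolve v l x r z (middle v l x ∧ not s) (middle l x r ∧ not t) (middle x r z ∧ not u)) t)
expand-to = toWitness {a? =
  ∀ˡ λ v → ∀ˡ λ l → ∀ˡ λ x → ∀ˡ λ r → ∀ˡ λ z → ∀ᵇ λ s → ∀ᵇ λ t → ∀ᵇ λ u →
  T? (allows (turn l) s) →-dec (T? (allows (turn x) t) →-dec (T? (allows (turn r) u) →-dec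
  (T? (not (s ∧ t)) →-dec (T? (not (t ∧ u)) →-dec
  T? (allows (evolve v l x r z (middle v l x ∧ not s) (middle l x r ∧ not t) (middle x r z ∧ not u)) t)))))} _

-- A new letter never permits more than the turned one, and at a middle it is `a` or `c`, which
-- fixes the state there. Hence the choice can be read off the row.
expand-from : ∀ v l x r z k₋ k k₊ t → (T k → T (middle l x r)) →
  T (allows (evolve v l x r z k₋ k k₊) t) → T (allows (turn x) t) × (middle l x r ∧ not t) ≡ k
expand-from = toWitness {a? =
  ∀ˡ λ v → ∀ˡ λ l → ∀ˡ λ x → ∀ˡ λ r → ∀ˡ λ z → ∀ᵇ λ k₋ → ∀ᵇ λ k → ∀ᵇ λ k₊ →
  ∀ᵇ λ t → (T? k →-dec T? (middle l x r)) →-dec (T? (allows (evolve v l x r z k₋ k k₊) t) →-dec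
  (T? (allows (turn x) t) ×-dec ((middle l x r ∧ not t) Bool.≟ k)))} _

allowed-isolated : ∀ v l x r z → T (allowed v l x r z) → ∀ s t →
  T (allows x s) → T (allows r t) → T (not (s ∧ t))
allowed-isolated = toWitness {a? =
  ∀ˡ λ v → ∀ˡ λ l → ∀ˡ λ x → ∀ˡ λ r → ∀ˡ λ z → T? (allowed v l x r z) →-dec
  (∀ᵇ λ s → ∀ᵇ λ t →
   T? (allows x s) →-dec (T? (allows r t) →-dec T? (not (s ∧ t))))} _

match-split : ∀ l x r k → match a a a l x r ≡ kept l x r k ℕ.+ lost l x r k
match-split l x r true  = refl
match-split l x r false = sym (ℕ.+-identityʳ _)

sum-≥ : ∀ {n} (F : Fin n → ℕ) i → F i ℕ.≤ sum F
sum-≥ F zero    = ℕ.m≤m+n _ _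
sum-≥ F (suc i) = ℕ.≤-trans (sum-≥ (F ∘ suc) i) (ℕ.m≤n+m _ _)

sum-≤ : ∀ {n} (F : Fin n → ℕ) d → (∀ i → F i ℕ.≤ d) → sum F ℕ.≤ n ℕ.* d
sum-≤ {zero}  F d F≤d = ℕ.z≤n
sum-≤ {suc n} F d F≤d = ℕ.+-mono-≤ (F≤d zero) (sum-≤ (F ∘ suc) d (F≤d ∘ suc))

-- Dynamics of words on a cycle and the conservation of walls

record Cyclic (H : Graph) : Set where
  field
    next prev : Fin (order H) → Fin (order H)
    next-prev : ∀ i → next (prev i) ≡ i
    prev-next : ∀ i → prev (next i) ≡ i
    adj-next  : ∀ i → Adj H i (next i)
    adj⇒next  : ∀ {u v} → Adj H u v → v ≡ next u ⊎ u ≡ next v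

module Dynamics (H : Graph) (cyclic : Cyclic H) where
  open Cyclic cyclic

  private
    N = order H

    -- `next (prev i)` equals `i` only propositionally, so the windows around neighbouring sites are
    -- rewritten in coordinates centred at `i`. On short cycles the sites of a window coincide; the
    -- local checks quantify over all letters and cover this.
    module Window {ℓ} {A : Set ℓ} (F : (v l x r z : Fin N) → A) where
      at : Fin N → A
      at i = F (prev (prev i)) (prev i) i (next i) (next (next i))

      at-prev : ∀ i → at (prev i) ≡ F (prev (prev (prev i))) (prev (prev i)) (prev i) i (next i)
      at-prev i = cong (λ j → F (prev (prev (prev i))) (prev (prev i)) (prev i) j (next j)) (next-prev i)

      at-prev² : ∀ i → at (prev (prev i)) ≡
        F (prev (prev (prev (prev i)))) (prev (prev (prev i))) (prev (prev i)) (prev i) i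
      at-prev² i = trans (at-prev (prev i)) (cong (F _ _ _ _) (next-prev i))

      at-next : ∀ i → at (next i) ≡ F (prev i) i (next i) (next (next i)) (next (next (next i)))
      at-next i = cong (λ j → F (prev j) j (next i) (next (next i)) (next (next (next i)))) (prev-next i)

      at-next² : ∀ i → at (next (next i)) ≡
        F i (next i) (next (next i)) (next (next (next i))) (next (next (next (next i))))
      at-next² i = trans (at-next (next i))
        (cong (λ j → F j (next i) (next (next i)) (next (next (next i))) _) (prev-next i))

  step : Subset N → Word N → Word N
  step κ w = Window.at λ v l x r z →
    evolve (w v) (w l) (w x) (w r) (w z) (lookup κ l) (lookup κ x) (lookup κ r)

  Allowed : Word N → Set
  Allowed w = ∀ i → Window.at (λ v l x r z → T (allowed (w v) (w l) (w x) (w r) (w z))) i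

  rank : Word N → ℕ
  rank w = sum λ i → density (w (prev i)) (w i) (w (next i))

  private
    rotation : Permutation N N
    rotation = permutation next prev next-prev prev-next

    -- This turns the local moves into a conservation law: a sum over the whole cycle does not see
    -- by how many sites a wall has moved.
    sum-next : (F : Fin N → ℕ) → sum (F ∘ next) ≡ sum F
    sum-next F = sym (sum-permute F rotation)

    sum-prev : (F : Fin N → ℕ) → sum (F ∘ prev) ≡ sum F
    sum-prev F = trans (sym (sum-next (F ∘ prev))) (sum-cong-≗ (cong F ∘ prev-next))

  module _ (κ : Subset N) (w : Word N) (ok : Allowed w) where
    private
      module S = Window (λ v l x r z →
        evolve (w v) (w l) (w x) (w r) (w z) (lookup κ l) (lookup κ x) (lookup κ r))
      module O = Window (λ v l x r z → T (allowed (w v) (w l) (w x) (w r) (w z)))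

      ok₋₂ = λ i → subst (λ P → P) (O.at-prev² i) (ok (prev (prev i)))
      ok₋₁ = λ i → subst (λ P → P) (O.at-prev i) (ok (prev i))
      ok₊₁ = λ i → subst (λ P → P) (O.at-next i) (ok (next i))
      ok₊₂ = λ i → subst (λ P → P) (O.at-next² i) (ok (next (next i)))

    step-allowed : Allowed (step κ w)
    step-allowed i
      rewrite S.at-prev² i | S.at-prev i | S.at-next i | S.at-next² i =
      evolve-allowed
        (w (prev (prev (prev (prev i))))) (w (prev (prev (prev i)))) (w (prev (prev i))) (w (prev i)) (w i)
        (ok₋₂ i) (w (next i)) (ok₋₁ i) (w (next (next i))) (ok i) (w (next (next (next i)))) (ok₊₁ i)
        (w (next (next (next (next i))))) (ok₊₂ i)
        (lookup κ (prev (prev (prev i)))) (lookup κ (prev (prev i))) (lookup κ (prev i)) (lookup κ i)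
        (lookup κ (next i)) (lookup κ (next (next i))) (lookup κ (next (next (next i))))

    private
      triple : {A : Set} → (Letter → Letter → Letter → A) → Fin N → A
      triple F i = F (w (prev i)) (w i) (w (next i))

      K L : Fin N → ℕ
      K i = triple kept i (lookup κ i)
      L i = triple lost i (lookup κ i)

    step-density : ∀ i →
      density (step κ w (prev i)) (step κ w i) (step κ w (next i)) ≡
      triple (match b a a) i ℕ.+ triple (match a a b) i ℕ.+ triple (match b a c) (prev i) ℕ.+
      triple (match c a b) (next i) ℕ.+ (K (prev (prev i)) ℕ.+ K (next (next i)))
    step-density i
      rewrite S.at-prev i | S.at-next i
            | next-prev (prev i) | next-prev i | prev-next i | prev-next (next i) =
      evolve-density (w (prev (prev (prev i)))) (w (prev (prev i))) (w (prev i)) (w i) (w (next i)) (ok₋₁ i)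
        (w (next (next i))) (ok i) (w (next (next (next i)))) (ok₊₁ i)
        (lookup κ (prev (prev i))) (lookup κ (prev i)) (lookup κ i) (lookup κ (next i)) (lookup κ (next (next i)))

    lostSum : ℕ
    lostSum = sum L

    -- Walls move but their total weight changes only by the middles at
    -- which two colliding walls are annihilated.
    rank-step : rank (step κ w) ℕ.+ 2 ℕ.* lostSum ≡ rank w
    rank-step = begin
      rank (step κ w) ℕ.+ 2 ℕ.* sum L
        ≡⟨ cong (ℕ._+ 2 ℕ.* sum L) (sum-cong-≗ step-density) ⟩
      sum (λ i → P i ℕ.+ Q i ℕ.+ R (prev i) ℕ.+ S (next i) ℕ.+ (K (prev (prev i)) ℕ.+ K (next (next i))))
        ℕ.+ 2 ℕ.* sum L
        ≡⟨ cong (ℕ._+ 2 ℕ.* sum L) (trans (sum₅ P Q (R ∘ prev) (S ∘ next) _)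
             (cong₂ ℕ._+_ (cong₂ (λ x y → sum P ℕ.+ sum Q ℕ.+ x ℕ.+ y) (sum-prev R) (sum-next S))
               (trans (∑-distrib-+ (K ∘ prev ∘ prev) (K ∘ next ∘ next))
                 (cong₂ ℕ._+_ (trans (sum-prev (K ∘ prev)) (sum-prev K))
                              (trans (sum-next (K ∘ next)) (sum-next K)))))) ⟩
      sum P ℕ.+ sum Q ℕ.+ sum R ℕ.+ sum S ℕ.+ (sum K ℕ.+ sum K) ℕ.+ 2 ℕ.* sum L
        ≡⟨ regroup (sum P) (sum Q) (sum R) (sum S) (sum K) (sum L) ⟩
      sum P ℕ.+ sum Q ℕ.+ sum R ℕ.+ sum S ℕ.+ ((sum K ℕ.+ sum L) ℕ.+ (sum K ℕ.+ sum L))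
        ≡⟨ cong (sum P ℕ.+ sum Q ℕ.+ sum R ℕ.+ sum S ℕ.+_)
             (sym (trans (∑-distrib-+ M M) (cong₂ ℕ._+_ sumM sumM))) ⟩
      sum P ℕ.+ sum Q ℕ.+ sum R ℕ.+ sum S ℕ.+ sum (λ i → M i ℕ.+ M i)
        ≡⟨ sym (sum₅ P Q R S (λ i → M i ℕ.+ M i)) ⟩
      sum (λ i → P i ℕ.+ Q i ℕ.+ R i ℕ.+ S i ℕ.+ (M i ℕ.+ M i))
        ≡⟨ sum-cong-≗ (λ i → cong (λ x → P i ℕ.+ Q i ℕ.+ R i ℕ.+ S i ℕ.+ (M i ℕ.+ x))
             (sym (ℕ.+-identityʳ (M i)))) ⟩
      rank w ∎
      where
      P Q R S M : Fin N → ℕ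
      P = triple (match b a a)
      Q = triple (match a a b)
      R = triple (match b a c)
      S = triple (match c a b)
      M = triple (match a a a)

      sumM : sum M ≡ sum K ℕ.+ sum L
      sumM = trans (sum-cong-≗ λ i → match-split (w (prev i)) (w i) (w (next i)) (lookup κ i))
                   (∑-distrib-+ K L)

      regroup : ∀ p q r s k l → p ℕ.+ q ℕ.+ r ℕ.+ s ℕ.+ (k ℕ.+ k) ℕ.+ 2 ℕ.* l ≡
                                p ℕ.+ q ℕ.+ r ℕ.+ s ℕ.+ ((k ℕ.+ l) ℕ.+ (k ℕ.+ l))
      regroup = ℕSolver.solve-∀

      sum₅ : ∀ P Q R S K → sum {N} (λ i → P i ℕ.+ Q i ℕ.+ R i ℕ.+ S i ℕ.+ K i) ≡
                           sum P ℕ.+ sum Q ℕ.+ sum R ℕ.+ sum S ℕ.+ sum K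
      sum₅ P Q R S K = trans (∑-distrib-+ (λ i → P i ℕ.+ Q i ℕ.+ R i ℕ.+ S i) K) (cong (ℕ._+ sum K)
        (trans (∑-distrib-+ (λ i → P i ℕ.+ Q i ℕ.+ R i) S) (cong (ℕ._+ sum S)
          (trans (∑-distrib-+ (λ i → P i ℕ.+ Q i) R) (cong (ℕ._+ sum R) (∑-distrib-+ P Q))))))

  Chosen : Word N → Subset N → Set
  Chosen w κ = ∀ i → T (lookup κ i) → T (middle (w (prev i)) (w i) (w (next i)))

  chosen? : ∀ w κ → Dec (Chosen w κ)
  chosen? w κ = Fin.all? λ i → T? (lookup κ i) →-dec T? (middle (w (prev i)) (w i) (w (next i)))

  -- The independent rows compatible with `turn ∘ w` are sorted by the set of
  -- middles that they leave free.
  choice : Word N → Subset N → Subset N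
  choice w τ = tabulate λ i → middle (w (prev i)) (w i) (w (next i)) ∧ not (lookup τ i)

  rank-step-≤ : ∀ κ w → Allowed w → rank (step κ w) ℕ.≤ rank w
  rank-step-≤ κ w ok = ℕ.≤-trans (ℕ.m≤m+n _ _) (ℕ.≤-reflexive (rank-step κ w ok))

  -- Every element of `κ` is a middle whose two walls annihilate each other.
  rank-step-< : ∀ κ w → Allowed w → Chosen w κ → ¬ Subset.⊥ ≡ κ → rank (step κ w) ℕ.< rank w
  rank-step-< κ w ok chosen ⊥≢κ with nonempty? κ
  ... | no  e         = contradiction (empty⇒⊥ κ e) ⊥≢κ
  ... | yes (i , i∈κ) = ℕ.<-≤-trans (ℕ.m<m+n _ (ℕ.≤-trans 1≤lost (ℕ.m≤m+n _ _)))
                                    (ℕ.≤-reflexive (rank-step κ w ok))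
    where
    lost-middle : ∀ l x r k → k ≡ true → T (middle l x r) → lost l x r k ≡ 1
    lost-middle a a a _ refl _ = refl

    κi : lookup κ i ≡ true
    κi = Vec.[]=⇒lookup i∈κ

    1≤lost : 1 ℕ.≤ lostSum κ w ok
    1≤lost = ℕ.≤-trans
      (ℕ.≤-reflexive (sym (lost-middle (w (prev i)) (w i) (w (next i)) _ κi (chosen i (subst T (sym κi) tt)))))
      (sum-≥ (λ i → lost (w (prev i)) (w i) (w (next i)) (lookup κ i)) i)

  no-neighbours : ∀ w → Allowed w → ∀ τ → Compatible w τ → ∀ i → i ∈ τ → next i ∉ τ
  no-neighbours w ok τ comp i i∈τ ni∈τ =
    subst₂ (λ s t → T (not (s ∧ t))) (Vec.[]=⇒lookup i∈τ) (Vec.[]=⇒lookup ni∈τ)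
      (allowed-isolated (w (prev (prev i))) (w (prev i)) (w i) (w (next i)) (w (next (next i))) (ok i)
        (lookup τ i) (lookup τ (next i)) (comp i) (comp (next i)))

  allowed⇒independent : ∀ w → Allowed w → ∀ τ → Compatible w τ → Independent H τ
  allowed⇒independent w ok τ comp u v u∈τ v∈τ adj with adj⇒next adj
  ... | inj₁ refl = no-neighbours w ok τ comp u u∈τ v∈τ
  ... | inj₂ refl = no-neighbours w ok τ comp v v∈τ u∈τ

  classify : ∀ w κ τ → Independent H τ →
    (choice w τ ≡ κ × Compatible (turn ∘ w) τ) ⇔ (Chosen w κ × Compatible (step κ w) τ)
  classify w κ τ ind = mk⇔ to from
    where
    apart : ∀ i → T (not (lookup τ i ∧ lookup τ (next i)))
    apart i with lookup τ i in τi | lookup τ (next i) in τni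
    ... | false | _     = tt
    ... | true  | false = tt
    ... | true  | true  = ind i (next i) (Vec.lookup⇒[]= _ _ τi) (Vec.lookup⇒[]= _ _ τni) (adj-next i)

    to : choice w τ ≡ κ × Compatible (turn ∘ w) τ → Chosen w κ × Compatible (step κ w) τ
    to (refl , comp) = chosen , compatible
      where
      mid : Fin N → Bool
      mid i = middle (w (prev i)) (w i) (w (next i))

      κ≡ : ∀ i → lookup (choice w τ) i ≡ mid i ∧ not (lookup τ i)
      κ≡ = Vec.lookup∘tabulate _

      chosen : Chosen w (choice w τ)
      chosen i κi = proj₁ (Equivalence.to Bool.T-∧ (subst T (κ≡ i) κi))

      compatible : Compatible (step (choice w τ) w) τ
      compatible i
        rewrite κ≡ (prev i) | κ≡ i | κ≡ (next i) | next-prev i | prev-next i =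
        expand-to (w (prev (prev i))) (w (prev i)) (w i) (w (next i)) (w (next (next i)))
          (lookup τ (prev i)) (lookup τ i) (lookup τ (next i))
          (comp (prev i)) (comp i) (comp (next i))
          (subst (λ j → T (not (lookup τ (prev i) ∧ lookup τ j))) (next-prev i) (apart (prev i)))
          (apart i)

    from : Chosen w κ × Compatible (step κ w) τ → choice w τ ≡ κ × Compatible (turn ∘ w) τ
    from (chosen , comp) =
      trans (Vec.tabulate-cong (proj₂ ∘ local)) (Vec.tabulate∘lookup κ) , proj₁ ∘ local
      where
      local = λ i → expand-from (w (prev (prev i))) (w (prev i)) (w i) (w (next i)) (w (next (next i)))
        (lookup κ (prev i)) (lookup κ i) (lookup κ (next i)) (lookup τ i) (chosen i) (comp i)

  wordCount-classify : ∀ w m →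
    wordCount H (turn ∘ w) m ≡ Σₛ N (λ κ → 𝟙 (chosen? w κ) * wordCount H (step κ w) m)
  wordCount-classify w m = begin
    Σₛ N (λ τ → 𝟙 (compatible? (turn ∘ w) τ) * weight H m τ)
      -- The factor 1 is inserted as the sum over `κ` of the indicators of `choice w τ ≡ κ`.
      ≡⟨ Σₛ-cong N (λ τ → sym (Σₛ-δ N (choice w τ)
           λ _ → 𝟙 (compatible? (turn ∘ w) τ) * weight H m τ)) ⟩
    Σₛ N (λ τ → Σₛ N λ κ → 𝟙 (choice w τ ≟ₛ κ) * (𝟙 (compatible? (turn ∘ w) τ) * weight H m τ))
      ≡⟨ Σₛ-swap N N _ ⟩
    Σₛ N (λ κ → Σₛ N λ τ → 𝟙 (choice w τ ≟ₛ κ) * (𝟙 (compatible? (turn ∘ w) τ) * weight H m τ))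
      ≡⟨ Σₛ-cong N (λ κ → trans (Σₛ-cong N (summand κ))
           (Σₛ-* N (𝟙 (chosen? w κ)) λ τ → 𝟙 (compatible? (step κ w) τ) * weight H m τ)) ⟩
    Σₛ N (λ κ → 𝟙 (chosen? w κ) * wordCount H (step κ w) m) ∎
    where
    regroup : ∀ x y z u → x * (y * (z * u)) ≡ z * (x * y * u)
    regroup = solve-∀

    summand : ∀ κ τ → 𝟙 (choice w τ ≟ₛ κ) * (𝟙 (compatible? (turn ∘ w) τ) * weight H m τ) ≡
                      𝟙 (chosen? w κ) * (𝟙 (compatible? (step κ w) τ) * weight H m τ)
    summand κ τ = begin
      𝟙 (choice w τ ≟ₛ κ) * (𝟙 (compatible? (turn ∘ w) τ) * weight H m τ)
        ≡⟨ regroup (𝟙 (choice w τ ≟ₛ κ)) (𝟙 (compatible? (turn ∘ w) τ)) (𝟙 (indep? H τ)) X ⟩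
      𝟙 (indep? H τ) * (𝟙 (choice w τ ≟ₛ κ) * 𝟙 (compatible? (turn ∘ w) τ) * X)
        -- The indicator of independence inside `weight` reduces the claim to independent rows, to
        -- which `classify` applies.
        ≡⟨ 𝟙-guard (indep? H τ) (λ ind → cong (_* X) (trans
             (sym (𝟙-× (choice w τ ≟ₛ κ) (compatible? (turn ∘ w) τ)))
             (trans (𝟙-cong (classify w κ τ ind)
                      ((choice w τ ≟ₛ κ) ×-dec compatible? (turn ∘ w) τ)
                      (chosen? w κ ×-dec compatible? (step κ w) τ))
                    (𝟙-× (chosen? w κ) (compatible? (step κ w) τ))))) ⟩
      𝟙 (indep? H τ) * (𝟙 (chosen? w κ) * 𝟙 (compatible? (step κ w) τ) * X)
        ≡⟨ sym (regroup (𝟙 (chosen? w κ)) (𝟙 (compatible? (step κ w) τ)) (𝟙 (indep? H τ)) X) ⟩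
      𝟙 (chosen? w κ) * (𝟙 (compatible? (step κ w) τ) * weight H m τ) ∎
      where X = sgn τ * count H m τ

  wordCount-suc : ∀ w → Allowed w → ∀ m → wordCount H w (suc m) ≡
    wordSign w * Σₛ N (λ κ → 𝟙 (chosen? w κ) * wordCount H (step κ w) m)
  wordCount-suc w ok m = trans
    (wordCount-turn H w (allowed⇒independent w ok) m)
    (cong (wordSign w *_) (wordCount-classify w m))

-- Differences with step K

-- The operator (S^K - 1)^r for the shift S; on generating functions it corresponds to
-- multiplication by (1 - t^K)^r, up to finitely many coefficients.
Δ : ℕ → ℕ → (ℕ → ℤ) → ℕ → ℤ
Δ K zero    s m = s m
Δ K (suc r) s m = Δ K r s (K ℕ.+ m) - Δ K r s m

Δ-cong : ∀ K r {s t : ℕ → ℤ} → s ≗ t → Δ K r s ≗ Δ K r t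
Δ-cong K zero    s≗t m = s≗t m
Δ-cong K (suc r) s≗t m = cong₂ _-_ (Δ-cong K r s≗t (K ℕ.+ m)) (Δ-cong K r s≗t m)

Δ-shift : ∀ K r (s : ℕ → ℤ) m → Δ K r (s ∘ suc) m ≡ Δ K r s (suc m)
Δ-shift K zero    s m = refl
Δ-shift K (suc r) s m = cong₂ _-_
  (trans (Δ-shift K r s (K ℕ.+ m)) (cong (Δ K r s) (sym (ℕ.+-suc K m)))) (Δ-shift K r s m)

Δ-* : ∀ K r x (s : ℕ → ℤ) m → Δ K r (λ k → x * s k) m ≡ x * Δ K r s m
Δ-* K zero    x s m = refl
Δ-* K (suc r) x s m = trans
  (cong₂ _-_ (Δ-* K r x s (K ℕ.+ m)) (Δ-* K r x s m))
  (factor x (Δ K r s (K ℕ.+ m)) (Δ K r s m))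
  where
  factor : ∀ x y z → x * y - x * z ≡ x * (y - z)
  factor = solve-∀

Δ-minus : ∀ K r (s t : ℕ → ℤ) m → Δ K r (λ k → s k - t k) m ≡ Δ K r s m - Δ K r t m
Δ-minus K zero    s t m = refl
Δ-minus K (suc r) s t m = trans
  (cong₂ _-_ (Δ-minus K r s t (K ℕ.+ m)) (Δ-minus K r s t m))
  (regroup (Δ K r s (K ℕ.+ m)) (Δ K r t (K ℕ.+ m)) (Δ K r s m) (Δ K r t m))
  where
  regroup : ∀ x y z u → (x - y) - (z - u) ≡ (x - z) - (y - u)
  regroup = solve-∀

Δ-Σₛ : ∀ K r n (F : Subset n → ℕ → ℤ) m →
       Δ K r (λ k → Σₛ n λ κ → F κ k) m ≡ Σₛ n λ κ → Δ K r (F κ) m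
Δ-Σₛ K zero    n F m = refl
Δ-Σₛ K (suc r) n F m = begin
  Δ K r (λ k → Σₛ n λ κ → F κ k) (K ℕ.+ m) - Δ K r (λ k → Σₛ n λ κ → F κ k) m
    ≡⟨ cong₂ _-_ (Δ-Σₛ K r n F (K ℕ.+ m)) (Δ-Σₛ K r n F m) ⟩
  Σₛ n (λ κ → Δ K r (F κ) (K ℕ.+ m)) - Σₛ n (λ κ → Δ K r (F κ) m)
    ≡⟨ cong (λ x → Σₛ n (λ κ → Δ K r (F κ) (K ℕ.+ m)) + x) (sym (ℤ.-1*i≡-i _)) ⟩
  Σₛ n (λ κ → Δ K r (F κ) (K ℕ.+ m)) + -1ℤ * Σₛ n (λ κ → Δ K r (F κ) m)
    ≡⟨ cong (λ x → Σₛ n (λ κ → Δ K r (F κ) (K ℕ.+ m)) + x) (sym (Σₛ-* n -1ℤ _)) ⟩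
  Σₛ n (λ κ → Δ K r (F κ) (K ℕ.+ m)) + Σₛ n (λ κ → -1ℤ * Δ K r (F κ) m)
    ≡⟨ sym (Σₛ-+ n _ _) ⟩
  Σₛ n (λ κ → Δ K r (F κ) (K ℕ.+ m) + -1ℤ * Δ K r (F κ) m)
    ≡⟨ Σₛ-cong n (λ κ → cong (λ x → Δ K r (F κ) (K ℕ.+ m) + x) (ℤ.-1*i≡-i (Δ K r (F κ) m))) ⟩
  Σₛ n (λ κ → Δ K (suc r) (F κ) m) ∎

periodic-multiple : ∀ (s : ℕ → ℤ) x₀ d → (∀ x → x₀ ℕ.≤ x → s (d ℕ.+ x) ≡ s x) →
  ∀ q x → x₀ ℕ.≤ x → s (q ℕ.* d ℕ.+ x) ≡ s x
periodic-multiple s x₀ d per zero    x x₀≤x = refl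
periodic-multiple s x₀ d per (suc q) x x₀≤x = begin
  s (d ℕ.+ q ℕ.* d ℕ.+ x)   ≡⟨ cong s (ℕ.+-assoc d (q ℕ.* d) x) ⟩
  s (d ℕ.+ (q ℕ.* d ℕ.+ x)) ≡⟨ per _ (ℕ.≤-trans x₀≤x (ℕ.m≤n+m x (q ℕ.* d))) ⟩
  s (q ℕ.* d ℕ.+ x)         ≡⟨ periodic-multiple s x₀ d per q x x₀≤x ⟩
  s x                       ∎

∣! : ∀ {d n} → 1 ℕ.≤ d → d ℕ.≤ n → d ∣ n !
∣! {suc d} _ d<n = ∣-trans (m∣m*n (d !)) (m≤n⇒m!∣n! d<n)

-- Periodicity by induction on the number of walls

module Killing (H : Graph) (cyclic : Cyclic H) where
  open Cyclic cyclic
  open Dynamics H cyclic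

  private
    N = order H

  -- There are 3^N words, so a repetition in an orbit has a distance d of at most 3^N, which divides
  -- the factorial. The factor 2 absorbs the sign acquired over d steps.
  states period : ℕ
  states = 3 ℕ.^ N
  period = 2 ℕ.* states !

  orbit : ℕ → Word N → Word N
  orbit zero    w = w
  orbit (suc j) w = orbit j (step Subset.⊥ w)

  module Graded (r : ℕ)
    (lower : ∀ w → Allowed w → rank w ℕ.< r → ∀ m → states ℕ.* r ℕ.≤ m → Δ period r (wordCount H w) m ≡ 0ℤ)
    where

    E : Word N → ℕ → ℤ
    E w = Δ period r (wordCount H w)

    -- Any nonempty choice drops the rank below `r`, where `r` differences already give zero. Only
    -- the term of the empty choice survives.
    E-suc : ∀ w → Allowed w → rank w ℕ.≤ r → ∀ m → states ℕ.* r ℕ.≤ m →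
            E w (suc m) ≡ wordSign w * E (step Subset.⊥ w) m
    E-suc w ok rank≤r m m≥ = begin
      E w (suc m)
        ≡⟨ sym (Δ-shift period r (wordCount H w) m) ⟩
      Δ period r (λ k → wordCount H w (suc k)) m
        ≡⟨ Δ-cong period r (wordCount-suc w ok) m ⟩
      Δ period r (λ k → wordSign w * Σₛ N (λ κ → 𝟙 (chosen? w κ) * wordCount H (step κ w) k)) m
        ≡⟨ Δ-* period r (wordSign w) _ m ⟩
      wordSign w * Δ period r (λ k → Σₛ N λ κ → 𝟙 (chosen? w κ) * wordCount H (step κ w) k) m
        ≡⟨ cong (wordSign w *_) (Δ-Σₛ period r N (λ κ k → 𝟙 (chosen? w κ) * wordCount H (step κ w) k) m) ⟩
      wordSign w * Σₛ N (λ κ → Δ period r (λ k → 𝟙 (chosen? w κ) * wordCount H (step κ w) k) m)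
        ≡⟨ cong (wordSign w *_) (Σₛ-cong N λ κ →
             trans (Δ-* period r (𝟙 (chosen? w κ)) (wordCount H (step κ w)) m) (only-⊥ κ)) ⟩
      wordSign w * Σₛ N (λ κ → 𝟙 (Subset.⊥ ≟ₛ κ) * E (step κ w) m)
        ≡⟨ cong (wordSign w *_) (Σₛ-δ N Subset.⊥ (λ κ → E (step κ w) m)) ⟩
      wordSign w * E (step Subset.⊥ w) m ∎
      where
      chosen-⊥ : Chosen w Subset.⊥
      chosen-⊥ i p = contradiction (subst T (Vec.lookup-replicate i outside) p) λ ()

      only-⊥ : ∀ κ → 𝟙 (chosen? w κ) * E (step κ w) m ≡ 𝟙 (Subset.⊥ ≟ₛ κ) * E (step κ w) m
      only-⊥ κ = case (Subset.⊥ ≟ₛ κ)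
        where
        case : (d : Dec (Subset.⊥ ≡ κ)) → 𝟙 (chosen? w κ) * E (step κ w) m ≡ 𝟙 d * E (step κ w) m
        case (yes refl) = cong (_* E (step κ w) m) (𝟙-yes (chosen? w κ) chosen-⊥)
        case (no ⊥≢κ)   = trans
          (𝟙-guard (chosen? w κ) λ chosen →
            lower (step κ w) (step-allowed κ w ok)
              (ℕ.<-≤-trans (rank-step-< κ w ok chosen ⊥≢κ) rank≤r) m m≥)
          (ℤ.*-zeroʳ (𝟙 (chosen? w κ)))

    -- Of the accumulated sign only `ε * ε ≡ 1ℤ` is remembered, which suffices because a repetition
    -- will be used twice.
    E-orbit : ∀ j w → Allowed w → rank w ℕ.≤ r →
      ∃ λ ε → ε * ε ≡ 1ℤ × (∀ m → states ℕ.* r ℕ.≤ m → E w (j ℕ.+ m) ≡ ε * E (orbit j w) m)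
    E-orbit zero    w ok rank≤r = 1ℤ , refl , λ m _ → sym (ℤ.*-identityˡ (E w m))
    E-orbit (suc j) w ok rank≤r
      with E-orbit j (step Subset.⊥ w) (step-allowed Subset.⊥ w ok)
             (ℕ.≤-trans (rank-step-≤ Subset.⊥ w ok) rank≤r)
    ... | ε , ε² , orb = wordSign w * ε , square , λ m m≥ → begin
      E w (suc (j ℕ.+ m))
        ≡⟨ E-suc w ok rank≤r (j ℕ.+ m) (ℕ.≤-trans m≥ (ℕ.m≤n+m m j)) ⟩
      wordSign w * E (step Subset.⊥ w) (j ℕ.+ m)
        ≡⟨ cong (wordSign w *_) (orb m m≥) ⟩
      wordSign w * (ε * E (orbit (suc j) w) m)
        ≡⟨ sym (ℤ.*-assoc (wordSign w) ε _) ⟩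
      wordSign w * ε * E (orbit (suc j) w) m ∎
      where
      regroup : ∀ x y → (x * y) * (x * y) ≡ (x * x) * (y * y)
      regroup = solve-∀

      square : (wordSign w * ε) * (wordSign w * ε) ≡ 1ℤ
      square = trans (regroup (wordSign w) ε) (cong₂ _*_ (wordSign² w) ε²)

    E-periodic : ∀ w → Allowed w → rank w ℕ.≤ r → ∀ m → states ℕ.* suc r ℕ.≤ m →
                 E w (period ℕ.+ m) ≡ E w m
    E-periodic w ok rank≤r m m≥
      -- Words are functions, so the pigeonhole principle is applied to their codes in `Fin states`;
      -- equal codes give words that agree pointwise.
      with Fin.pigeonhole (ℕ.n<1+n states) (λ (j : Fin (suc states)) → funToFin (orbit (toℕ j) w))
    ... | i , j , i<j , same
      with E-orbit (toℕ i) w ok rank≤r | E-orbit (toℕ j) w ok rank≤r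
    ... | ε , ε² , orbᵢ | η , η² , orbⱼ
      with ∣! (ℕ.m<n⇒0<n∸m i<j) (ℕ.≤-trans (ℕ.m∸n≤m (toℕ j) (toℕ i)) (ℕ.s≤s⁻¹ (Fin.toℕ<n j)))
    ... | divides q S!≡q*d = begin
      E w (period ℕ.+ m)            ≡⟨ cong (λ x → E w (x ℕ.+ m)) period≡ ⟩
      E w (q ℕ.* (d ℕ.+ d) ℕ.+ m)   ≡⟨ periodic-multiple (E w) (toℕ i ℕ.+ states ℕ.* r) (d ℕ.+ d) twice q m m≥′ ⟩
      E w m                         ∎
      where
      d : ℕ
      d = toℕ j ∸ toℕ i

      period≡ : period ≡ q ℕ.* (d ℕ.+ d)
      period≡ = trans (cong (2 ℕ.*_) S!≡q*d) (regroup q d)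
        where
        regroup : ∀ q d → 2 ℕ.* (q ℕ.* d) ≡ q ℕ.* (d ℕ.+ d)
        regroup = ℕSolver.solve-∀

      -- The first of the two equal iterates occurs after at most `states` steps, so each level of
      -- the induction raises the threshold by `states`.
      m≥′ : toℕ i ℕ.+ states ℕ.* r ℕ.≤ m
      m≥′ = ℕ.≤-trans (ℕ.+-monoˡ-≤ (states ℕ.* r) (ℕ.s≤s⁻¹ (Fin.toℕ<n i)))
              (ℕ.≤-trans (ℕ.≤-reflexive (sym (ℕ.*-suc states r))) m≥)

      same-word : orbit (toℕ i) w ≗ orbit (toℕ j) w
      same-word k = trans (sym (Fin.finToFun-funToFin (orbit (toℕ i) w) k))
        (trans (cong (λ x → finToFun x k) same) (Fin.finToFun-funToFin (orbit (toℕ j) w) k))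

      j≡ : ∀ x → d ℕ.+ (toℕ i ℕ.+ x) ≡ toℕ j ℕ.+ x
      j≡ x = trans (sym (ℕ.+-assoc d (toℕ i) x)) (cong (ℕ._+ x) (ℕ.m∸n+n≡m (ℕ.<⇒≤ i<j)))

      once : ∀ x → toℕ i ℕ.+ states ℕ.* r ℕ.≤ x → E w (d ℕ.+ x) ≡ (η * ε) * E w x
      once x x≥ = begin
        E w (d ℕ.+ x)                  ≡⟨ cong (λ x → E w (d ℕ.+ x)) (sym x≡) ⟩
        E w (d ℕ.+ (toℕ i ℕ.+ y))      ≡⟨ cong (E w) (j≡ y) ⟩
        E w (toℕ j ℕ.+ y)              ≡⟨ orbⱼ y y≥ ⟩
        η * E (orbit (toℕ j) w) y
          ≡⟨ cong (η *_) (Δ-cong period r (wordCount-cong H (sym ∘ same-word)) y) ⟩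
        η * E (orbit (toℕ i) w) y      ≡⟨ cong (η *_) (sym (ℤ.*-identityˡ _)) ⟩
        η * (1ℤ * E (orbit (toℕ i) w) y)
          -- Since `ε` is its own inverse, the relation at `i` can be solved for the value on the
          -- orbit.
          ≡⟨ cong (λ x → η * (x * E (orbit (toℕ i) w) y)) (sym ε²) ⟩
        η * ((ε * ε) * E (orbit (toℕ i) w) y)
          ≡⟨ regroup η ε (E (orbit (toℕ i) w) y) ⟩
        (η * ε) * (ε * E (orbit (toℕ i) w) y)
          ≡⟨ cong ((η * ε) *_) (sym (orbᵢ y y≥)) ⟩
        (η * ε) * E w (toℕ i ℕ.+ y)    ≡⟨ cong (λ x → (η * ε) * E w x) x≡ ⟩
        (η * ε) * E w x                ∎
        where
        y : ℕ
        y = x ∸ toℕ i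

        x≡ : toℕ i ℕ.+ y ≡ x
        x≡ = ℕ.m+[n∸m]≡n (ℕ.m+n≤o⇒m≤o (toℕ i) x≥)

        y≥ : states ℕ.* r ℕ.≤ y
        y≥ = ℕ.≤-trans (ℕ.≤-reflexive (sym (ℕ.m+n∸m≡n (toℕ i) _))) (ℕ.∸-monoˡ-≤ (toℕ i) x≥)

        regroup : ∀ η ε e → η * ((ε * ε) * e) ≡ (η * ε) * (ε * e)
        regroup = solve-∀

      twice : ∀ x → toℕ i ℕ.+ states ℕ.* r ℕ.≤ x → E w (d ℕ.+ d ℕ.+ x) ≡ E w x
      twice x x≥ = begin
        E w (d ℕ.+ d ℕ.+ x)            ≡⟨ cong (E w) (ℕ.+-assoc d d x) ⟩
        E w (d ℕ.+ (d ℕ.+ x))          ≡⟨ once _ (ℕ.≤-trans x≥ (ℕ.m≤n+m x d)) ⟩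
        (η * ε) * E w (d ℕ.+ x)        ≡⟨ cong ((η * ε) *_) (once x x≥) ⟩
        (η * ε) * ((η * ε) * E w x)    ≡⟨ regroup η ε (E w x) ⟩
        ((η * η) * (ε * ε)) * E w x    ≡⟨ cong (_* E w x) (cong₂ _*_ η² ε²) ⟩
        1ℤ * E w x                     ≡⟨ ℤ.*-identityˡ _ ⟩
        E w x                          ∎
        where
        regroup : ∀ η ε e → (η * ε) * ((η * ε) * e) ≡ ((η * η) * (ε * ε)) * e
        regroup = solve-∀

  -- Periodicity of the r-th differences is the vanishing of the next ones. The strict bound on the
  -- rank leaves no word for `r` equal to 0.
  killed : ∀ r w → Allowed w → rank w ℕ.< r → ∀ m → states ℕ.* r ℕ.≤ m → Δ period r (wordCount H w) m ≡ 0ℤ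
  killed (suc r) w ok rank<1+r m m≥ =
    ℤ.i≡j⇒i-j≡0 (Graded.E-periodic r (killed r) w ok (ℕ.s≤s⁻¹ rank<1+r) m m≥)

-- Starting words

infixl 6 _[_]≔ʷ_
_[_]≔ʷ_ : ∀ {n} → Word n → Fin n → Letter → Word n
w [ j ]≔ʷ x = updateAt w j (const x)

module _ (H : Graph) where
  private
    N = order H

  -- The letter `b` permits both states, so writing it at `j` isolates the condition on the other
  -- sites.
  compatible-update : ∀ (w : Word N) j x τ →
    𝟙 (compatible? (w [ j ]≔ʷ x) τ) ≡ bit (allows x (lookup τ j)) * 𝟙 (compatible? (w [ j ]≔ʷ b) τ)
  compatible-update w j x τ = trans
    (𝟙-cong (mk⇔ to from) (compatible? (w [ j ]≔ʷ x) τ)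
      (T? (allows x (lookup τ j)) ×-dec compatible? (w [ j ]≔ʷ b) τ))
    (𝟙-× (T? (allows x (lookup τ j))) (compatible? (w [ j ]≔ʷ b) τ))
    where
    allows-at : Fin N → Letter → Set
    allows-at i x = T (allows x (lookup τ i))

    to : Compatible (w [ j ]≔ʷ x) τ → allows-at j x × Compatible (w [ j ]≔ʷ b) τ
    to p = subst (allows-at j) (updateAt-updates j w) (p j) , λ i → case i (i Fin.≟ j)
      where
      case : ∀ i → Dec (i ≡ j) → allows-at i ((w [ j ]≔ʷ b) i)
      case i (yes refl) = subst (allows-at i) (sym (updateAt-updates i w)) tt
      case i (no i≢j)   = subst (allows-at i)
        (trans (updateAt-minimal i j w i≢j) (sym (updateAt-minimal i j w i≢j))) (p i)

    from : allows-at j x × Compatible (w [ j ]≔ʷ b) τ → Compatible (w [ j ]≔ʷ x) τ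
    from (q , p) i = case i (i Fin.≟ j)
      where
      case : ∀ i → Dec (i ≡ j) → allows-at i ((w [ j ]≔ʷ x) i)
      case i (yes refl) = subst (allows-at i) (sym (updateAt-updates i w)) q
      case i (no i≢j)   = subst (allows-at i)
        (trans (updateAt-minimal i j w i≢j) (sym (updateAt-minimal i j w i≢j))) (p i)

  -- As covectors, a = b - c.
  wordCount-split : ∀ (w : Word N) j m → wordCount H (w [ j ]≔ʷ a) m ≡
                    wordCount H (w [ j ]≔ʷ b) m - wordCount H (w [ j ]≔ʷ c) m
  wordCount-split w j m = begin
    Σₛ N (λ τ → 𝟙 (compatible? (w [ j ]≔ʷ a) τ) * weight H m τ)
      ≡⟨ Σₛ-cong N split ⟩
    Σₛ N (λ τ → B τ * weight H m τ + -1ℤ * (C τ * weight H m τ))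
      ≡⟨ Σₛ-+ N (λ τ → B τ * weight H m τ) _ ⟩
    wordCount H (w [ j ]≔ʷ b) m + Σₛ N (λ τ → -1ℤ * (C τ * weight H m τ))
      ≡⟨ cong (λ x → wordCount H (w [ j ]≔ʷ b) m + x)
           (trans (Σₛ-* N -1ℤ (λ τ → C τ * weight H m τ)) (ℤ.-1*i≡-i (wordCount H (w [ j ]≔ʷ c) m))) ⟩
    wordCount H (w [ j ]≔ʷ b) m - wordCount H (w [ j ]≔ʷ c) m ∎
    where
    B C : Subset N → ℤ
    B τ = 𝟙 (compatible? (w [ j ]≔ʷ b) τ)
    C τ = 𝟙 (compatible? (w [ j ]≔ʷ c) τ)

    site : ∀ s x y → bit (not s) * x * y ≡ x * y + -1ℤ * (bit s * x * y)
    site true  = solve-∀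
    site false = solve-∀

    split : ∀ τ → 𝟙 (compatible? (w [ j ]≔ʷ a) τ) * weight H m τ ≡
                  B τ * weight H m τ + -1ℤ * (C τ * weight H m τ)
    split τ = trans (cong (_* weight H m τ) (compatible-update w j a τ))
      (trans (site (lookup τ j) (B τ) (weight H m τ))
        (cong (λ x → B τ * weight H m τ + -1ℤ * (x * weight H m τ)) (sym (compatible-update w j c τ))))

density≤2 : ∀ l x r → density l x r ℕ.≤ 2
density≤2 = toWitness {a? = ∀ˡ λ l → ∀ˡ λ x → ∀ˡ λ r → density l x r ℕ.≤? 2} _

allowed-full : ∀ v l x r z → l ≢ a → x ≡ a → r ≢ a → T (allowed v l x r z)
allowed-full v a _ r z l≢a refl r≢a = contradiction refl l≢a
allowed-full v b _ a z l≢a refl r≢a = contradiction refl r≢a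
allowed-full v b _ b z l≢a refl r≢a = tt
allowed-full v b _ c z l≢a refl r≢a = tt
allowed-full v c _ a z l≢a refl r≢a = contradiction refl r≢a
allowed-full v c _ b z l≢a refl r≢a = tt
allowed-full v c _ c z l≢a refl r≢a = tt

allowed-isolate : ∀ v l x r z → l ≡ a → x ≢ a → r ≡ a → T (allowed v l x r z)
allowed-isolate v _ a _ z refl x≢a refl = contradiction refl x≢a
allowed-isolate v _ b _ z refl x≢a refl = tt
allowed-isolate v _ c _ z refl x≢a refl = tt

module Start (H : Graph) (cyclic : Cyclic H)
  (colour : Fin (order H) → Bool) (colour-next : ∀ i → colour (Cyclic.next cyclic i) ≡ not (colour i)) where
  open Cyclic cyclic
  open Dynamics H cyclic
  open Killing H cyclic

  private
    N = order H

  colour-prev : ∀ i → colour (prev i) ≡ not (colour i)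
  colour-prev i = trans (sym (Bool.not-involutive _))
    (cong not (trans (sym (colour-next (prev i))) (cong colour (next-prev i))))

  -- Every run of `a` has length 1, which is permitted between any two other letters.
  full⇒allowed : ∀ (w : Word N) → (∀ i → colour i ≡ false → w i ≡ a) → (∀ i → colour i ≡ true → w i ≢ a) →
                 Allowed w
  full⇒allowed w empty full i with colour i in ci
  ... | true  = allowed-isolate _ _ _ _ _
    (empty (prev i) (trans (colour-prev i) (cong not ci))) (full i ci)
    (empty (next i) (trans (colour-next i) (cong not ci)))
  ... | false = allowed-full _ _ _ _ _
    (full (prev i) (trans (colour-prev i) (cong not ci))) (empty i ci)
    (full (next i) (trans (colour-next i) (cong not ci)))

  -- Each of the `N` sites contributes at most 2 to the rank, and `killed` asks for a strict
  -- inequality, hence the successor.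
  rank-bound exponent threshold : ℕ
  rank-bound = N ℕ.* 2
  exponent   = suc rank-bound
  threshold  = states ℕ.* exponent

  Killed : Word N → Set
  Killed w = ∀ m → threshold ℕ.≤ m → Δ period exponent (wordCount H w) m ≡ 0ℤ

  -- Induction on the number `J` of initial sites that may still need splitting. At `J` equal to `N`
  -- the word `a…a` qualifies, and at 0 the word is in the class.
  killed-start : ∀ J (w : Word N) → (∀ i → colour i ≡ false → w i ≡ a) →
    (∀ i → colour i ≡ true → J ℕ.≤ toℕ i → w i ≢ a) → Killed w
  killed-start zero w empty full = killed exponent w
    (full⇒allowed w empty λ i ci → full i ci ℕ.z≤n)
    (ℕ.s≤s (sum-≤ _ 2 λ i → density≤2 (w (prev i)) (w i) (w (next i))))
  killed-start (suc J) w empty full = case (J ℕ.<? N)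
    where
    stronger : (∀ i → toℕ i ≡ J → colour i ≡ true → w i ≢ a) → Killed w
    stronger full-J = killed-start J w empty λ i ci J≤i →
      Sum.[ (λ J<i → full i ci J<i) , (λ J≡i → full-J i (sym J≡i) ci) ] (ℕ.m≤n⇒m<n∨m≡n J≤i)

    case : Dec (J ℕ.< N) → Killed w
    case (no J≮N)  = stronger λ i i≡J → contradiction (subst (ℕ._< N) i≡J (Fin.toℕ<n i)) J≮N
    case (yes J<N) = at (colour j) refl (w j Fin.≟ a)
      where
      j : Fin N
      j = fromℕ< J<N

      j-unique : ∀ {i} → toℕ i ≡ J → i ≡ j
      j-unique i≡J = Fin.toℕ-injective (trans i≡J (sym (Fin.toℕ-fromℕ< J<N)))

      at : ∀ s → colour j ≡ s → Dec (w j ≡ a) → Killed w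
      at false cj _          = stronger λ i i≡J ci → contradiction
        (trans (sym ci) (trans (cong colour (j-unique i≡J)) cj)) λ ()
      at true  cj (no wj≢a)  = stronger λ i i≡J _ wi≡a → wj≢a (trans (cong w (sym (j-unique i≡J))) wi≡a)
      at true  cj (yes wj≡a) m m≥ = begin
        Δ period exponent (wordCount H w) m
          ≡⟨ Δ-cong period exponent (λ k → trans (wordCount-cong H w≗ k) (wordCount-split H w j k)) m ⟩
        Δ period exponent (λ k → wordCount H (w [ j ]≔ʷ b) k - wordCount H (w [ j ]≔ʷ c) k) m
          ≡⟨ Δ-minus period exponent (wordCount H (w [ j ]≔ʷ b)) (wordCount H (w [ j ]≔ʷ c)) m ⟩
        Δ period exponent (wordCount H (w [ j ]≔ʷ b)) m - Δ period exponent (wordCount H (w [ j ]≔ʷ c)) m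
          ≡⟨ cong₂ _-_ (updated b (λ ()) m m≥) (updated c (λ ()) m m≥) ⟩
        0ℤ ∎
        where
        w≗ : w ≗ (w [ j ]≔ʷ a)
        w≗ i with i Fin.≟ j
        ... | yes refl = trans wj≡a (sym (updateAt-updates j w))
        ... | no i≢j   = sym (updateAt-minimal i j w i≢j)

        updated : ∀ x → x ≢ a → Killed (w [ j ]≔ʷ x)
        updated x x≢a = killed-start J (w [ j ]≔ʷ x) empty′ full′
          where
          empty′ : ∀ i → colour i ≡ false → (w [ j ]≔ʷ x) i ≡ a
          empty′ i ci = trans (updateAt-minimal i j w i≢j) (empty i ci)
            where
            i≢j : i ≢ j
            i≢j refl = contradiction (trans (sym ci) cj) λ ()

          full′ : ∀ i → colour i ≡ true → J ℕ.≤ toℕ i → (w [ j ]≔ʷ x) i ≢ a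
          full′ i ci J≤i eq with i Fin.≟ j
          ... | yes refl = x≢a (trans (sym (updateAt-updates j w)) eq)
          ... | no i≢j   = full i ci
            (ℕ.≤∧≢⇒< J≤i λ J≡i → i≢j (j-unique (sym J≡i)))
            (trans (sym (updateAt-minimal i j w i≢j)) eq)

  Z-killed : ∀ m → threshold ℕ.≤ m → Δ period exponent (λ k → Z (path k □ H)) m ≡ 0ℤ
  Z-killed m m≥ = trans (Δ-cong period exponent (Z≡wordCount H) m)
    (killed-start N (λ _ → a) (λ _ _ → refl)
      (λ i _ N≤i → contradiction (Fin.toℕ<n i) (ℕ.≤⇒≯ N≤i)) m m≥)

-- The cyclic order on Fin (suc n)

module _ {n : ℕ} where
  private
    fromView : {i : Fin (suc n)} → View i → Fin (suc n)
    fromView ‵fromℕ       = zero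
    fromView (‵inject₁ i) = suc i

  rotate unrotate : Fin (suc n) → Fin (suc n)
  rotate i = fromView (view i)
  unrotate zero    = fromℕ n
  unrotate (suc i) = inject₁ i

  rotate-unrotate : ∀ i → rotate (unrotate i) ≡ i
  rotate-unrotate zero    = cong fromView (view-fromℕ n)
  rotate-unrotate (suc i) = cong fromView (view-inject₁ i)

  unrotate-rotate : ∀ i → unrotate (rotate i) ≡ i
  unrotate-rotate i with view i
  ... | ‵fromℕ     = refl
  ... | ‵inject₁ i = refl

-- Two or more vertices ensure that rotation fixes none. For exactly two it swaps them, and `next`
-- and `prev` coincide.
cycle-cyclic : ∀ n → Cyclic (cycle (suc (suc n)))
cycle-cyclic n = record
  { next      = rotate
  ; prev      = unrotate
  ; next-prev = rotate-unrotate
  ; prev-next = unrotate-rotate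
  ; adj-next  = adj-rotate
  ; adj⇒next  = λ (_ , adj) → Sum.map next⇒rotate next⇒rotate adj
  }
  where
  Next : (i j : Fin (suc (suc n))) → Set
  Next i j = suc (toℕ i) ≡ toℕ j ⊎ (suc (toℕ i) ≡ suc (suc n) × toℕ j ≡ 0)

  adj-rotate : ∀ i → Adj (cycle (suc (suc n))) i (rotate i)
  adj-rotate i with view i
  ... | ‵fromℕ     = (λ ()) , inj₁ (inj₂ (cong suc (Fin.toℕ-fromℕ (suc n)) , refl))
  ... | ‵inject₁ i =
    (λ eq → ℕ.1+n≢n (sym (trans (sym (Fin.toℕ-inject₁ i)) (cong toℕ eq)))) ,
    inj₁ (inj₁ (cong suc (Fin.toℕ-inject₁ i)))

  next⇒rotate : ∀ {i j} → Next i j → j ≡ rotate i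
  next⇒rotate {i} {j} ij with view i
  next⇒rotate {j = j} (inj₁ 1+i≡j)   | ‵fromℕ = contradiction
    (ℕ.<-≤-trans (Fin.toℕ<n j) (ℕ.≤-reflexive (trans (cong suc (sym (Fin.toℕ-fromℕ (suc n)))) 1+i≡j)))
    (ℕ.<-irrefl refl)
  next⇒rotate (inj₂ (_ , j≡0))       | ‵fromℕ = Fin.toℕ-injective j≡0
  next⇒rotate (inj₁ 1+i≡j)           | ‵inject₁ i =
    Fin.toℕ-injective (trans (sym 1+i≡j) (cong suc (Fin.toℕ-inject₁ i)))
  next⇒rotate (inj₂ (1+i≡2+n , _))   | ‵inject₁ i = contradiction
    (trans (sym (Fin.toℕ-inject₁ i)) (ℕ.suc-injective 1+i≡2+n))
    (ℕ.<⇒≢ (Fin.toℕ<n i))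

odd : ℕ → Bool
odd zero    = false
odd (suc n) = not (odd n)

-- Evenness of the cycle enters here, at the edge from the last vertex back to 0: it makes parity a
-- proper 2-colouring.
odd-rotate : ∀ {n} → odd (suc n) ≡ false → ∀ (i : Fin (suc n)) → odd (toℕ (rotate i)) ≡ not (odd (toℕ i))
odd-rotate {n} even i with view i
... | ‵fromℕ     = trans (sym even) (cong (not ∘ odd) (sym (Fin.toℕ-fromℕ n)))
... | ‵inject₁ i = cong (not ∘ odd) (sym (Fin.toℕ-inject₁ i))

-- The denominator (1 - t^K)^r

subtract : Poly → Poly → Poly
subtract []      q       = List.map -_ q
subtract (x ∷ p) []      = x ∷ p
subtract (x ∷ p) (y ∷ q) = x - y ∷ subtract p q

denominator : ℕ → ℕ → Poly
denominator K zero    = 1ℤ ∷ []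
denominator K (suc r) = subtract (denominator K r) (replicate K 0ℤ ++ denominator K r)

-- The Cauchy product by recursion on the polynomial; the clause for `zero` cuts off the terms in
-- which the index of `s` would become negative.
convolve : Poly → (ℕ → ℤ) → ℕ → ℤ
convolve []      s k       = 0ℤ
convolve (x ∷ q) s zero    = x * s zero
convolve (x ∷ q) s (suc k) = x * s (suc k) + convolve q s k

⊛≡convolve : ∀ q s k → (coeff q ⊛ s) k ≡ convolve q s k
⊛≡convolve q s k = trans
  (cong sumℤ (List.map-applyUpTo (λ i → i) (λ i → coeff q i * s (k ∸ i)) (suc k)))
  (go q k)
  where
  vanish : ∀ n (F : ℕ → ℤ) → sumℤ (applyUpTo (λ i → 0ℤ * F i) n) ≡ 0ℤ
  vanish zero    F = refl
  vanish (suc n) F = trans (ℤ.+-identityˡ _) (vanish n (F ∘ suc))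

  go : ∀ q k → sumℤ (applyUpTo (λ i → coeff q i * s (k ∸ i)) (suc k)) ≡ convolve q s k
  go []      k       = vanish (suc k) (λ i → s (k ∸ i))
  go (x ∷ q) zero    = ℤ.+-identityʳ (x * s zero)
  go (x ∷ q) (suc k) = cong (x * s (suc k) +_) (go q k)

convolve-neg : ∀ q s k → convolve (List.map -_ q) s k ≡ 0ℤ - convolve q s k
convolve-neg []      s k       = refl
convolve-neg (y ∷ q) s zero    = neg y (s zero)
  where
  neg : ∀ y z → (- y) * z ≡ 0ℤ - y * z
  neg = solve-∀
convolve-neg (y ∷ q) s (suc k) = trans (cong ((- y) * s (suc k) +_) (convolve-neg q s k))
  (regroup y (s (suc k)) (convolve q s k))
  where
  regroup : ∀ y z u → (- y) * z + (0ℤ - u) ≡ 0ℤ - (y * z + u)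
  regroup = solve-∀

convolve-subtract : ∀ p q s k → convolve (subtract p q) s k ≡ convolve p s k - convolve q s k
convolve-subtract []      q       s k       = convolve-neg q s k
convolve-subtract (x ∷ p) []      s k       = sym (ℤ.+-identityʳ _)
convolve-subtract (x ∷ p) (y ∷ q) s zero    = distrib x y (s zero)
  where
  distrib : ∀ x y z → (x - y) * z ≡ x * z - y * z
  distrib = solve-∀
convolve-subtract (x ∷ p) (y ∷ q) s (suc k) = trans
  (cong ((x - y) * s (suc k) +_) (convolve-subtract p q s k))
  (regroup x y (s (suc k)) (convolve p s k) (convolve q s k))
  where
  regroup : ∀ x y z u v → (x - y) * z + (u - v) ≡ (x * z + u) - (y * z + v)
  regroup = solve-∀

convolve-shift : ∀ K q s k → convolve (replicate K 0ℤ ++ q) s (K ℕ.+ k) ≡ convolve q s k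
convolve-shift zero    q s k = refl
convolve-shift (suc K) q s k = trans (ℤ.+-identityˡ _) (convolve-shift K q s k)

-- The offset `r ℕ.* K` is the degree of the denominator, so that no term of the product is cut off.
convolve-denominator : ∀ K r s m → convolve (denominator K r) s (r ℕ.* K ℕ.+ m) ≡ Δ K r s m
convolve-denominator K zero    s zero    = ℤ.*-identityˡ (s zero)
convolve-denominator K zero    s (suc m) = trans (ℤ.+-identityʳ _) (ℤ.*-identityˡ (s (suc m)))
convolve-denominator K (suc r) s m = begin
  convolve (denominator K (suc r)) s (K ℕ.+ r ℕ.* K ℕ.+ m)
    ≡⟨ convolve-subtract (denominator K r) (replicate K 0ℤ ++ denominator K r) s _ ⟩
  convolve (denominator K r) s (K ℕ.+ r ℕ.* K ℕ.+ m) -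
  convolve (replicate K 0ℤ ++ denominator K r) s (K ℕ.+ r ℕ.* K ℕ.+ m)
    ≡⟨ cong₂ _-_
         (trans (cong (convolve (denominator K r) s) (regroup K (r ℕ.* K) m))
                (convolve-denominator K r s (K ℕ.+ m)))
         (trans (cong (convolve (replicate K 0ℤ ++ denominator K r) s) (ℕ.+-assoc K (r ℕ.* K) m))
                (trans (convolve-shift K (denominator K r) s (r ℕ.* K ℕ.+ m))
                       (convolve-denominator K r s m))) ⟩
  Δ K r s (K ℕ.+ m) - Δ K r s m ∎
  where
  regroup : ∀ x y z → x ℕ.+ y ℕ.+ z ≡ y ℕ.+ (x ℕ.+ z)
  regroup = ℕSolver.solve-∀

coeff-subtract : ∀ p q → coeff (subtract p q) 0 ≡ coeff p 0 - coeff q 0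
coeff-subtract []      []      = refl
coeff-subtract []      (y ∷ q) = sym (ℤ.+-identityˡ (- y))
coeff-subtract (x ∷ p) []      = sym (ℤ.+-identityʳ x)
coeff-subtract (x ∷ p) (y ∷ q) = refl

-- For positive `K` the subtracted shift leaves the constant term alone; this is how the denominator
-- is seen to be nonzero.
coeff-denominator : ∀ {K} r → 1 ℕ.≤ K → coeff (denominator K r) 0 ≡ 1ℤ
coeff-denominator         zero    _   = refl
coeff-denominator {suc K} (suc r) 1≤K = trans
  (coeff-subtract (denominator (suc K) r) (replicate (suc K) 0ℤ ++ denominator (suc K) r))
  (cong (_- 0ℤ) (coeff-denominator r 1≤K))

coeff-applyUpTo : ∀ n (F : ℕ → ℤ) → (∀ k → n ℕ.≤ k → F k ≡ 0ℤ) → ∀ k → coeff (applyUpTo F n) k ≡ F k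
coeff-applyUpTo zero    F F≡0 k       = sym (F≡0 k ℕ.z≤n)
coeff-applyUpTo (suc n) F F≡0 zero    = refl
coeff-applyUpTo (suc n) F F≡0 (suc k) = coeff-applyUpTo n (F ∘ suc) (λ k n≤k → F≡0 (suc k) (ℕ.s≤s n≤k)) k

-- Gaussian rationals

ℚ[i] : Set
ℚ[i] = ℚ × ℚ

infixl 6 _+ᵍ_ _-ᵍ_
infixl 7 _*ᵍ_
infixr 8 _^ᵍ_ _^ℚ_

_+ᵍ_ _-ᵍ_ _*ᵍ_ : ℚ[i] → ℚ[i] → ℚ[i]
(x , y) +ᵍ (x′ , y′) = x ℚ.+ x′ , y ℚ.+ y′
(x , y) -ᵍ (x′ , y′) = x ℚ.- x′ , y ℚ.- y′
(x , y) *ᵍ (x′ , y′) = x ℚ.* x′ ℚ.- y ℚ.* y′ , x ℚ.* y′ ℚ.+ y ℚ.* x′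

ofℤ : ℤ → ℚ[i]
ofℤ k = k ℚ./ 1 , 0ℚ

1ᵍ : ℚ[i]
1ᵍ = ofℤ 1ℤ

_^ᵍ_ : ℚ[i] → ℕ → ℚ[i]
u ^ᵍ zero  = 1ᵍ
u ^ᵍ suc k = u *ᵍ u ^ᵍ k

evalᵍ : Poly → ℚ[i] → ℚ[i]
evalᵍ []      u = ofℤ 0ℤ
evalᵍ (k ∷ p) u = ofℤ k +ᵍ u *ᵍ evalᵍ p u

-- The squared modulus, which stays rational and is multiplicative.
norm : ℚ[i] → ℚ
norm (x , y) = x ℚ.* x ℚ.+ y ℚ.* y

_^ℚ_ : ℚ → ℕ → ℚ
x ^ℚ zero  = 1ℚ
x ^ℚ suc k = x ℚ.* x ^ℚ k

ℚ-ring : AlmostCommutativeRing 0ℓ 0ℓ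
ℚ-ring = fromCommutativeRing ℚ.+-*-commutativeRing (λ x → dec⇒maybe (0ℚ ℚ.≟ x))

/1-minus : ∀ k l → (k - l) ℚ./ 1 ≡ k ℚ./ 1 ℚ.- l ℚ./ 1
/1-minus k l = ℚ.toℚᵘ-injective (ℚᵘ.≃-trans
  (ℚᵘ.≃-trans (ℚ.toℚᵘ-fromℚᵘ (ℚᵘ.mkℚᵘ (k - l) 0)) (ℚᵘ.*≡* (expand k l)))
  (ℚᵘ.≃-sym (ℚᵘ.≃-trans (ℚ.toℚᵘ-homo-+ (k ℚ./ 1) (ℚ.- (l ℚ./ 1)))
    (ℚᵘ.+-cong (ℚ.toℚᵘ-fromℚᵘ (ℚᵘ.mkℚᵘ k 0))
      (ℚᵘ.≃-trans (ℚ.toℚᵘ-homo‿- (l ℚ./ 1)) (ℚᵘ.-‿cong (ℚ.toℚᵘ-fromℚᵘ (ℚᵘ.mkℚᵘ l 0))))))))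
  where
  expand : ∀ k l → (k - l) * 1ℤ ≡ (k * 1ℤ + (- l) * 1ℤ) * 1ℤ
  expand = solve-∀

ofℤ-minus : ∀ k l → ofℤ (k - l) ≡ ofℤ k -ᵍ ofℤ l
ofℤ-minus k l = cong (_, 0ℚ) (/1-minus k l)

norm-* : ∀ u v → norm (u *ᵍ v) ≡ norm u ℚ.* norm v
norm-* (x , y) (x′ , y′) = brahmagupta x y x′ y′
  where
  brahmagupta : ∀ x y x′ y′ →
    (x ℚ.* x′ ℚ.- y ℚ.* y′) ℚ.* (x ℚ.* x′ ℚ.- y ℚ.* y′) ℚ.+ (x ℚ.* y′ ℚ.+ y ℚ.* x′) ℚ.* (x ℚ.* y′ ℚ.+ y ℚ.* x′) ≡
    (x ℚ.* x ℚ.+ y ℚ.* y) ℚ.* (x′ ℚ.* x′ ℚ.+ y′ ℚ.* y′)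
  brahmagupta = Solver.solve-∀ ℚ-ring

norm-^ : ∀ u r → norm (u ^ᵍ r) ≡ norm u ^ℚ r
norm-^ u zero    = refl
norm-^ u (suc r) = trans (norm-* u (u ^ᵍ r)) (cong (norm u ℚ.*_) (norm-^ u r))

horner-minus : ∀ k l u e f →
  (ofℤ k -ᵍ ofℤ l) +ᵍ u *ᵍ (e -ᵍ f) ≡ (ofℤ k +ᵍ u *ᵍ e) -ᵍ (ofℤ l +ᵍ u *ᵍ f)
horner-minus k l (x , y) (e₁ , e₂) (f₁ , f₂) =
  cong₂ _,_ (re (k ℚ./ 1) (l ℚ./ 1) x y e₁ e₂ f₁ f₂) (im x y e₁ e₂ f₁ f₂)
  where
  re : ∀ k l x y e₁ e₂ f₁ f₂ →
    (k ℚ.- l) ℚ.+ (x ℚ.* (e₁ ℚ.- f₁) ℚ.- y ℚ.* (e₂ ℚ.- f₂)) ≡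
    (k ℚ.+ (x ℚ.* e₁ ℚ.- y ℚ.* e₂)) ℚ.- (l ℚ.+ (x ℚ.* f₁ ℚ.- y ℚ.* f₂))
  re = Solver.solve-∀ ℚ-ring

  im : ∀ x y e₁ e₂ f₁ f₂ →
    (0ℚ ℚ.- 0ℚ) ℚ.+ (x ℚ.* (e₂ ℚ.- f₂) ℚ.+ y ℚ.* (e₁ ℚ.- f₁)) ≡
    (0ℚ ℚ.+ (x ℚ.* e₂ ℚ.+ y ℚ.* e₁)) ℚ.- (0ℚ ℚ.+ (x ℚ.* f₂ ℚ.+ y ℚ.* f₁))
  im = Solver.solve-∀ ℚ-ring

-ᵍ-identityʳ : ∀ u → u -ᵍ ofℤ 0ℤ ≡ u
-ᵍ-identityʳ (x , y) = cong₂ _,_ (ℚ.+-identityʳ x) (ℚ.+-identityʳ y)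

evalᵍ-neg : ∀ q u → evalᵍ (List.map -_ q) u ≡ ofℤ 0ℤ -ᵍ evalᵍ q u
evalᵍ-neg []      u = refl
evalᵍ-neg (l ∷ q) u = begin
  ofℤ (- l) +ᵍ u *ᵍ evalᵍ (List.map -_ q) u
    ≡⟨ cong₂ (λ x y → x +ᵍ u *ᵍ y) (trans (cong ofℤ (sym (ℤ.+-identityˡ (- l)))) (ofℤ-minus 0ℤ l)) (evalᵍ-neg q u) ⟩
  (ofℤ 0ℤ -ᵍ ofℤ l) +ᵍ u *ᵍ (ofℤ 0ℤ -ᵍ evalᵍ q u)
    ≡⟨ horner-minus 0ℤ l u (ofℤ 0ℤ) (evalᵍ q u) ⟩
  (ofℤ 0ℤ +ᵍ u *ᵍ ofℤ 0ℤ) -ᵍ evalᵍ (l ∷ q) u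
    ≡⟨ cong (_-ᵍ evalᵍ (l ∷ q) u) (vanish u) ⟩
  ofℤ 0ℤ -ᵍ evalᵍ (l ∷ q) u ∎
  where
  vanish : ∀ u → ofℤ 0ℤ +ᵍ u *ᵍ ofℤ 0ℤ ≡ ofℤ 0ℤ
  vanish (x , y) = cong₂ _,_ (re x y) (im x y)
    where
    re : ∀ x y → 0ℚ ℚ.+ (x ℚ.* 0ℚ ℚ.- y ℚ.* 0ℚ) ≡ 0ℚ
    re = Solver.solve-∀ ℚ-ring
    im : ∀ x y → 0ℚ ℚ.+ (x ℚ.* 0ℚ ℚ.+ y ℚ.* 0ℚ) ≡ 0ℚ
    im = Solver.solve-∀ ℚ-ring

evalᵍ-subtract : ∀ p q u → evalᵍ (subtract p q) u ≡ evalᵍ p u -ᵍ evalᵍ q u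
evalᵍ-subtract []      q       u = evalᵍ-neg q u
evalᵍ-subtract (k ∷ p) []      u = sym (-ᵍ-identityʳ (evalᵍ (k ∷ p) u))
evalᵍ-subtract (k ∷ p) (l ∷ q) u = trans
  (cong₂ (λ x y → x +ᵍ u *ᵍ y) (ofℤ-minus k l) (evalᵍ-subtract p q u))
  (horner-minus k l u (evalᵍ p u) (evalᵍ q u))

*ᵍ-assoc : ∀ u v w → (u *ᵍ v) *ᵍ w ≡ u *ᵍ (v *ᵍ w)
*ᵍ-assoc (x₁ , y₁) (x₂ , y₂) (x₃ , y₃) = cong₂ _,_ (re x₁ y₁ x₂ y₂ x₃ y₃) (im x₁ y₁ x₂ y₂ x₃ y₃)
  where
  re : ∀ x₁ y₁ x₂ y₂ x₃ y₃ →
    (x₁ ℚ.* x₂ ℚ.- y₁ ℚ.* y₂) ℚ.* x₃ ℚ.- (x₁ ℚ.* y₂ ℚ.+ y₁ ℚ.* x₂) ℚ.* y₃ ≡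
    x₁ ℚ.* (x₂ ℚ.* x₃ ℚ.- y₂ ℚ.* y₃) ℚ.- y₁ ℚ.* (x₂ ℚ.* y₃ ℚ.+ y₂ ℚ.* x₃)
  re = Solver.solve-∀ ℚ-ring
  im : ∀ x₁ y₁ x₂ y₂ x₃ y₃ →
    (x₁ ℚ.* x₂ ℚ.- y₁ ℚ.* y₂) ℚ.* y₃ ℚ.+ (x₁ ℚ.* y₂ ℚ.+ y₁ ℚ.* x₂) ℚ.* x₃ ≡
    x₁ ℚ.* (x₂ ℚ.* y₃ ℚ.+ y₂ ℚ.* x₃) ℚ.+ y₁ ℚ.* (x₂ ℚ.* x₃ ℚ.- y₂ ℚ.* y₃)
  im = Solver.solve-∀ ℚ-ring

evalᵍ-shift : ∀ K q u → evalᵍ (replicate K 0ℤ ++ q) u ≡ u ^ᵍ K *ᵍ evalᵍ q u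
evalᵍ-shift zero    q u = sym (1-* (evalᵍ q u))
  where
  1-* : ∀ v → 1ᵍ *ᵍ v ≡ v
  1-* (x , y) = cong₂ _,_ (re x y) (im x y)
    where
    re : ∀ x y → 1ℚ ℚ.* x ℚ.- 0ℚ ℚ.* y ≡ x
    re = Solver.solve-∀ ℚ-ring
    im : ∀ x y → 1ℚ ℚ.* y ℚ.+ 0ℚ ℚ.* x ≡ y
    im = Solver.solve-∀ ℚ-ring
evalᵍ-shift (suc K) q u = trans (0-+ _)
  (trans (cong (u *ᵍ_) (evalᵍ-shift K q u)) (sym (*ᵍ-assoc u (u ^ᵍ K) (evalᵍ q u))))
  where
  0-+ : ∀ v → ofℤ 0ℤ +ᵍ v ≡ v
  0-+ (x , y) = cong₂ _,_ (ℚ.+-identityˡ x) (ℚ.+-identityˡ y)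

evalᵍ-denominator : ∀ K r u → evalᵍ (denominator K r) u ≡ (1ᵍ -ᵍ u ^ᵍ K) ^ᵍ r
evalᵍ-denominator K zero    (x , y) = cong₂ _,_ (re x y) (im x y)
  where
  re : ∀ x y → 1ℚ ℚ.+ (x ℚ.* 0ℚ ℚ.- y ℚ.* 0ℚ) ≡ 1ℚ
  re = Solver.solve-∀ ℚ-ring
  im : ∀ x y → 0ℚ ℚ.+ (x ℚ.* 0ℚ ℚ.+ y ℚ.* 0ℚ) ≡ 0ℚ
  im = Solver.solve-∀ ℚ-ring
evalᵍ-denominator K (suc r) u = begin
  evalᵍ (denominator K (suc r)) u
    ≡⟨ evalᵍ-subtract (denominator K r) (replicate K 0ℤ ++ denominator K r) u ⟩
  evalᵍ (denominator K r) u -ᵍ evalᵍ (replicate K 0ℤ ++ denominator K r) u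
    ≡⟨ cong (evalᵍ (denominator K r) u -ᵍ_) (evalᵍ-shift K (denominator K r) u) ⟩
  evalᵍ (denominator K r) u -ᵍ u ^ᵍ K *ᵍ evalᵍ (denominator K r) u
    ≡⟨ factor (u ^ᵍ K) (evalᵍ (denominator K r) u) ⟩
  (1ᵍ -ᵍ u ^ᵍ K) *ᵍ evalᵍ (denominator K r) u
    ≡⟨ cong ((1ᵍ -ᵍ u ^ᵍ K) *ᵍ_) (evalᵍ-denominator K r u) ⟩
  (1ᵍ -ᵍ u ^ᵍ K) ^ᵍ suc r ∎
  where
  factor : ∀ v e → e -ᵍ v *ᵍ e ≡ (1ᵍ -ᵍ v) *ᵍ e
  factor (x , y) (e₁ , e₂) = cong₂ _,_ (re x y e₁ e₂) (im x y e₁ e₂)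
    where
    re : ∀ x y e₁ e₂ → e₁ ℚ.- (x ℚ.* e₁ ℚ.- y ℚ.* e₂) ≡ (1ℚ ℚ.- x) ℚ.* e₁ ℚ.- (0ℚ ℚ.- y) ℚ.* e₂
    re = Solver.solve-∀ ℚ-ring
    im : ∀ x y e₁ e₂ → e₂ ℚ.- (x ℚ.* e₂ ℚ.+ y ℚ.* e₁) ≡ (1ℚ ℚ.- x) ℚ.* e₂ ℚ.+ (0ℚ ℚ.- y) ℚ.* e₁
    im = Solver.solve-∀ ℚ-ring

open ℝ
open ℂ

-- Estimates in ℚ: a small power has a small base

∣p∣²≡p² : ∀ p → ∣ p ∣ ℚ.* ∣ p ∣ ≡ p ℚ.* p
∣p∣²≡p² p with ℚ.∣p∣≡p∨∣p∣≡-p p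
... | inj₁ eq = cong₂ ℚ._*_ eq eq
... | inj₂ eq = trans (cong₂ ℚ._*_ eq eq) (neg² p)
  where
  neg² : ∀ p → (ℚ.- p) ℚ.* (ℚ.- p) ≡ p ℚ.* p
  neg² = Solver.solve-∀ ℚ-ring

*-mono-≤ : ∀ {p q r s} → 0ℚ ℚ.≤ p → 0ℚ ℚ.≤ s → p ℚ.≤ q → r ℚ.≤ s → p ℚ.* r ℚ.≤ q ℚ.* s
*-mono-≤ {p} {q} {r} {s} 0≤p 0≤s p≤q r≤s = ℚ.≤-trans
  (ℚ.*-monoˡ-≤-nonNeg p {{nonNegative 0≤p}} r≤s) (ℚ.*-monoʳ-≤-nonNeg s {{nonNegative 0≤s}} p≤q)

*-pos : ∀ {p q} → 0ℚ ℚ.< p → 0ℚ ℚ.< q → 0ℚ ℚ.< p ℚ.* q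
*-pos {p} {q} 0<p 0<q = ℚ.positive⁻¹ (p ℚ.* q) {{ℚ.pos*pos⇒pos p {{positive 0<p}} q {{positive 0<q}}}}

0≤p² : ∀ p → 0ℚ ℚ.≤ p ℚ.* p
0≤p² p = subst (0ℚ ℚ.≤_) (∣p∣²≡p² p)
  (*-mono-≤ {0ℚ} {∣ p ∣} {0ℚ} ℚ.≤-refl (ℚ.0≤∣p∣ p) (ℚ.0≤∣p∣ p) (ℚ.0≤∣p∣ p))

^-pos : ∀ {p} r → 0ℚ ℚ.< p → 0ℚ ℚ.< p ^ℚ r
^-pos zero    0<p = ℚ.positive⁻¹ 1ℚ
^-pos (suc r) 0<p = *-pos 0<p (^-pos r 0<p)

^-mono-≤ : ∀ {p q} r → 0ℚ ℚ.< p → p ℚ.≤ q → p ^ℚ r ℚ.≤ q ^ℚ r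
^-mono-≤ zero    0<p p≤q = ℚ.≤-refl
^-mono-≤ (suc r) 0<p p≤q =
  *-mono-≤ (ℚ.<⇒≤ 0<p) (ℚ.≤-trans (ℚ.<⇒≤ (^-pos r 0<p)) (^-mono-≤ r 0<p p≤q)) p≤q (^-mono-≤ r 0<p p≤q)

^-square : ∀ p r → (p ℚ.* p) ^ℚ r ≡ p ^ℚ r ℚ.* p ^ℚ r
^-square p zero    = refl
^-square p (suc r) = trans (cong ((p ℚ.* p) ℚ.*_) (^-square p r)) (regroup p (p ^ℚ r))
  where
  regroup : ∀ p q → (p ℚ.* p) ℚ.* (q ℚ.* q) ≡ (p ℚ.* q) ℚ.* (p ℚ.* q)
  regroup = Solver.solve-∀ ℚ-ring

p²<q² : ∀ p {q} → 0ℚ ℚ.< q → ∣ p ∣ ℚ.< q → p ℚ.* p ℚ.< q ℚ.* q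
p²<q² p {q} 0<q p<q = subst (ℚ._< q ℚ.* q) (∣p∣²≡p² p) (ℚ.≤-<-trans
  (ℚ.*-monoˡ-≤-nonNeg ∣ p ∣ {{nonNegative (ℚ.0≤∣p∣ p)}} (ℚ.<⇒≤ p<q))
  (ℚ.*-monoˡ-<-pos q {{positive 0<q}} p<q))

norm-small : ∀ w r {ε} → 0ℚ ℚ.< ε → norm (w ^ᵍ r) ℚ.< (ε ℚ.* ε) ^ℚ r → norm w ℚ.< ε ℚ.* ε
norm-small w r {ε} 0<ε small with norm w ℚ.<? ε ℚ.* ε
... | yes lt = lt
... | no ¬lt = contradiction (ℚ.<-≤-trans small (ℚ.≤-trans
  (^-mono-≤ r (*-pos 0<ε 0<ε) (ℚ.≮⇒≥ ¬lt))
  (ℚ.≤-reflexive (sym (norm-^ w r))))) (ℚ.<-irrefl refl)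

coordinate-small : ∀ p {s ε} → 0ℚ ℚ.< ε → p ℚ.* p ℚ.≤ s → s ℚ.< ε ℚ.* ε → ∣ p ∣ ℚ.< ε
coordinate-small p {s} {ε} 0<ε p²≤s s<ε² with ∣ p ∣ ℚ.<? ε
... | yes lt = lt
... | no ¬lt = contradiction (ℚ.≤-<-trans
  (ℚ.≤-trans (*-mono-≤ (ℚ.<⇒≤ 0<ε) (ℚ.0≤∣p∣ p) (ℚ.≮⇒≥ ¬lt) (ℚ.≮⇒≥ ¬lt))
    (ℚ.≤-trans (ℚ.≤-reflexive (∣p∣²≡p² p)) p²≤s)) s<ε²) (ℚ.<-irrefl refl)

-- Two coordinates below half of ε^r have squares that add up to less than half of (ε²)^r, which
-- bounds the norm of the power.
margin : ℚ → ℕ → ℚ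
margin ε r = ½ ℚ.* ε ^ℚ r

margin-pos : ∀ {ε} r → 0ℚ ℚ.< ε → 0ℚ ℚ.< margin ε r
margin-pos r 0<ε = *-pos (ℚ.positive⁻¹ ½) (^-pos r 0<ε)

-- The norm of `w ^ᵍ r` is the r-th power of the norm of `w`. No root is extracted: the order on ℚ
-- is decidable, so the bounds follow by contraposition.
root-small : ∀ w r {ε} → 0ℚ ℚ.< ε →
  ∣ proj₁ (w ^ᵍ r) ∣ ℚ.< margin ε r → ∣ proj₂ (w ^ᵍ r) ∣ ℚ.< margin ε r →
  ∣ proj₁ w ∣ ℚ.< ε × ∣ proj₂ w ∣ ℚ.< ε
root-small w@(x , y) r {ε} 0<ε X<δ Y<δ =
    coordinate-small x 0<ε
      (subst (ℚ._≤ norm w) (ℚ.+-identityʳ (x ℚ.* x)) (ℚ.+-monoʳ-≤ (x ℚ.* x) (0≤p² y))) norm<ε²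
  , coordinate-small y 0<ε
      (subst (ℚ._≤ norm w) (ℚ.+-identityˡ (y ℚ.* y)) (ℚ.+-monoˡ-≤ (y ℚ.* y) (0≤p² x))) norm<ε²
  where
  t = ε ^ℚ r

  halved : ∀ t → ½ ℚ.* t ℚ.* (½ ℚ.* t) ℚ.+ ½ ℚ.* t ℚ.* (½ ℚ.* t) ≡ (½ ℚ.* ½ ℚ.+ ½ ℚ.* ½) ℚ.* (t ℚ.* t)
  halved = Solver.solve-∀ ℚ-ring

  norm<ε² : norm w ℚ.< ε ℚ.* ε
  norm<ε² = norm-small w r 0<ε (ℚ.<-≤-trans
    (ℚ.+-mono-< (p²<q² (proj₁ (w ^ᵍ r)) (margin-pos r 0<ε) X<δ) (p²<q² (proj₂ (w ^ᵍ r)) (margin-pos r 0<ε) Y<δ))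
    (ℚ.≤-trans (ℚ.≤-reflexive (halved t))
      (ℚ.≤-trans (ℚ.*-monoʳ-≤-nonNeg (t ℚ.* t) {{nonNegative (0≤p² t)}} {½} {1ℚ} (ℚ.≤ᵇ⇒≤ _))
        (ℚ.≤-reflexive (trans (ℚ.*-identityˡ (t ℚ.* t)) (sym (^-square ε r)))))))

-- The operations of ℂ act on sequences index by index, so polynomial
-- identities hold in ℚ[i] at every index.

at : ℂ → ℕ → ℚ[i]
at z n = seq (re z) n , seq (im z) n

at-^ : ∀ z k n → at (z ^ℂ k) n ≡ at z n ^ᵍ k
at-^ z zero    n = refl
at-^ z (suc k) n = cong (at z n *ᵍ_) (at-^ z k n)

at-eval : ∀ p z n → at (eval p z) n ≡ evalᵍ p (at z n)
at-eval []      z n = refl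
at-eval (k ∷ p) z n = cong (λ u → ofℤ k +ᵍ at z n *ᵍ u) (at-eval p z n)

-- At each index the value of the denominator is exactly the r-th power of `1ᵍ -ᵍ at z n ^ᵍ K`, so
-- its smallness passes to the base with an explicit modulus and no zero factor has to be located.
denominator-root : ∀ K r z → eval (denominator K r) z ≈ℂ 0ℂ → z ^ℂ K ≈ℂ 1ℂ
denominator-root K r z (re≈0 , im≈0) =
    (λ ε 0<ε → let N , close = converges ε 0<ε in N , λ n N≤n → proj₁ (close n N≤n))
  , (λ ε 0<ε → let N , close = converges ε 0<ε in N , λ n N≤n → proj₂ (close n N≤n))
  where
  Converges : ℚ → Set
  Converges ε = ∃ λ N → ∀ n → N ℕ.≤ n →
    ∣ seq (re (z ^ℂ K)) n ℚ.- 1ℚ ∣ ℚ.< ε × ∣ seq (im (z ^ℂ K)) n ℚ.- 0ℚ ∣ ℚ.< ε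

  ∣-∣-swap : ∀ p q → ∣ p ℚ.- q ∣ ≡ ∣ q ℚ.- p ∣
  ∣-∣-swap p q = trans (cong ∣_∣ (neg p q)) (ℚ.∣-p∣≡∣p∣ (q ℚ.- p))
    where
    neg : ∀ p q → p ℚ.- q ≡ ℚ.- (q ℚ.- p)
    neg = Solver.solve-∀ ℚ-ring

  converges : ∀ ε → 0ℚ ℚ.< ε → Converges ε
  converges ε 0<ε
    with re≈0 (margin ε r) (margin-pos r 0<ε) | im≈0 (margin ε r) (margin-pos r 0<ε)
  ... | M , re< | N , im< = M ⊔ N , λ n n≥ →
    let w     = 1ᵍ -ᵍ at z n ^ᵍ K
        w^r≡  = trans (at-eval (denominator K r) z n) (evalᵍ-denominator K r (at z n))
        X<δ , Y<δ = subst (λ u → ∣ proj₁ u ∣ ℚ.< margin ε r × ∣ proj₂ u ∣ ℚ.< margin ε r) w^r≡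
          ( subst (λ u → ∣ u ∣ ℚ.< margin ε r) (ℚ.+-identityʳ _) (re< n (ℕ.m⊔n≤o⇒m≤o M N n≥))
          , subst (λ u → ∣ u ∣ ℚ.< margin ε r) (ℚ.+-identityʳ _) (im< n (ℕ.m⊔n≤o⇒n≤o M N n≥)))
        x<ε , y<ε = root-small w r 0<ε X<δ Y<δ
    in subst (λ u → ∣ proj₁ u ℚ.- 1ℚ ∣ ℚ.< ε × ∣ proj₂ u ℚ.- 0ℚ ∣ ℚ.< ε) (sym (at-^ z K n))
         ( subst (ℚ._< ε) (∣-∣-swap 1ℚ (proj₁ (at z n ^ᵍ K))) x<ε
         , subst (ℚ._< ε) (∣-∣-swap 0ℚ (proj₂ (at z n ^ᵍ K))) y<ε)

-- Rationality

even-double : ∀ k → odd (2 ℕ.* k) ≡ false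
even-double zero    = refl
even-double (suc k) = trans (cong odd (ℕ.*-suc 2 k)) (trans (Bool.not-involutive _) (even-double k))

RationalWithCyclotomicPoles : PowerSeries → Set
RationalWithCyclotomicPoles g =
  ∃ λ (p : Poly) → ∃ λ (q : Poly) →
  (¬ IsZero q) × (g ≈ p /ₚ q) × (∀ (z : ℂ) → eval q z ≈ℂ 0ℂ → RootOfUnity z)

killed⇒rational : ∀ g K r x₀ → 1 ℕ.≤ K → (∀ m → x₀ ℕ.≤ m → Δ K r g m ≡ 0ℤ) → RationalWithCyclotomicPoles g
killed⇒rational g K r x₀ 1≤K vanish =
    -- The numerator is the product of denominator and series, truncated at `B`, from which on its
    -- coefficients vanish.
    applyUpTo (convolve q g) B
  , q
  , (λ q≡0 → contradiction (trans (sym (coeff-denominator r 1≤K)) (q≡0 0)) λ ())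
  , (λ k → trans (⊛≡convolve q g k) (sym (coeff-applyUpTo B (convolve q g) beyond k)))
  , λ z q[z]≈0 → K , 1≤K , denominator-root K r z q[z]≈0
  where
  q = denominator K r
  B = r ℕ.* K ℕ.+ x₀

  beyond : ∀ k → B ℕ.≤ k → convolve q g k ≡ 0ℤ
  beyond k B≤k = begin
    convolve q g k
      ≡⟨ cong (convolve q g) (sym (ℕ.m+[n∸m]≡n (ℕ.m+n≤o⇒m≤o (r ℕ.* K) B≤k))) ⟩
    convolve q g (r ℕ.* K ℕ.+ (k ∸ r ℕ.* K))
      ≡⟨ convolve-denominator K r g (k ∸ r ℕ.* K) ⟩
    Δ K r g (k ∸ r ℕ.* K)
      ≡⟨ vanish _ (subst (ℕ._≤ k ∸ r ℕ.* K) (ℕ.m+n∸m≡n (r ℕ.* K) x₀) (ℕ.∸-monoˡ-≤ (r ℕ.* K) B≤k)) ⟩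
    0ℤ ∎

rational : ∀ k → RationalWithCyclotomicPoles (f (suc (suc (2 ℕ.* k))))
rational k = killed⇒rational (f (suc (suc (2 ℕ.* k)))) period exponent threshold
  (ℕ.≤-trans (ℕ.1≤n! states) (ℕ.m≤m+n (states !) _)) Z-killed
  where
  H : Graph
  H = cycle (suc (suc (2 ℕ.* k)))

  open Killing H (cycle-cyclic (2 ℕ.* k)) using (period; states)
  open Start H (cycle-cyclic (2 ℕ.* k)) (odd ∘ toℕ)
    (odd-rotate (trans (Bool.not-involutive _) (even-double k)))

theorem1p3 : ∀ (n : ℕ) → 1 ℕ.≤ n →
    ∃ λ (p : Poly) → ∃ λ (q : Poly) →
    (¬ IsZero q) ×
    (f (2 ℕ.* n) ≈ p /ₚ q) ×
    (∀ (z : ℂ) → eval q z ≈ℂ 0ℂ → RootOfUnity z)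
theorem1p3 (suc k) _ = subst (λ N → RationalWithCyclotomicPoles (f N)) (sym (ℕ.*-suc 2 k)) (rational k)
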